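{- Let $a\geq 15$ be an integer, let $\rho$ be the root greater than $a+1$ of $x^3-ax^2-(a+3)x-1$, with conjugates $\rho',\rho''$ satisfying $-2<\rho'<-1$ and $-1<\rho''<0$, and let $\gamma=a^2+a+8+(a^2-a+1)\rho+(2-a)\rho^2\in\mathbb{Z}[\rho]$. Let $\beta$ be a non-unit $\sigma$-indecomposable integer in $\mathbb{Z}[\rho]$ for some signature $\sigma$. If $\gamma\succeq\beta^2$, then $\beta^2$ is one of the following elements: \begin{enumerate} \item $\rho'^2\rho''^2(-\rho+\rho^2)^2=1-2\rho+\rho^2$, \item $\rho''^2\rho^2(-\rho'+\rho'^2)^2=a^2+a+1+(a^2-a+1)\rho-(a-1)\rho^2$, \item $\rho''^2\rho^2(-2\rho'+\rho'^2)^2=a^2-a+(a^2-3a+1)\rho-(a-3)\rho^2$, \item $\rho^2\rho'^2(-(a-1)\rho''+\rho''^2)^2=a^2+a-1+(a^2-a-3)\rho-(a-2)\rho^2$. \end{enumerate}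
   Context: The polynomial $x^3-ax^2-(a+3)x-1$ is irreducible over $\mathbb{Q}$ with three real roots $\rho,\rho',\rho''$, labelled so that $a+1<\rho$, $-2<\rho'<-1$, $-1<\rho''<0$. The field $K=\mathbb{Q}(\rho)$ is cyclic cubic, so $\rho',\rho''\in K$; for $\alpha\in K$, $\alpha'$ and $\alpha''$ denote the images of $\alpha$ under the $\mathbb{Q}$-isomorphisms given by $\rho\mapsto\rho'$ and $\rho\mapsto\rho''$ respectively. The signature of a nonzero $\alpha\in K$ is the triple $(\mathrm{sgn}(\alpha),\mathrm{sgn}(\alpha'),\mathrm{sgn}(\alpha''))\in\{+,-\}^3$. For a signature $\sigma\in\{+,-\}^3$, $\mathbb{Z}[\rho]^{\sigma}$ is the set of elements of $\mathbb{Z}[\rho]$ with signature $\sigma$. An element $\alpha\in\mathbb{Z}[\rho]^{\sigma}$ is $\sigma$-indecomposable in $\mathbb{Z}[\rho]$ if it cannot be written as $\alpha=\beta_1+\beta_2$ with $\beta_1,\beta_2\in\mathbb{Z}[\rho]^{\sigma}$. An element is totally positive if it has signature $(+,+,+)$. For totally positive $\alpha,\beta\in\mathbb{Z}[\rho]$, $\alpha\succ\beta$ means $\alpha>\beta$, $\alpha'>\beta'$ and $\alpha''>\beta''$; $\alpha\succeq\beta$ means $\alpha\succ\beta$ or $\alpha=\beta$. -}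

module Defs where

open import Data.Integer as ℤ using (ℤ; +_)
open import Data.Nat as ℕ using (ℕ)
import Data.Nat.Properties as ℕₚ
open import Data.Product using (∃-syntax; _×_; _,_)
open import Data.Rational as ℚ using (ℚ; 0ℚ; 1ℚ; ½; ∣_∣; 1/_)
open import Data.Rational.Properties as ℚₚ using (module ≤-Reasoning)
open import Data.Rational.Solver using (module +-*-Solver)
open import Data.Sign as Sign using (Sign)
open import Data.Sum using (_⊎_)
open import Relation.Binary.PropositionalEquality
  using (_≡_; refl; sym; trans; cong; cong₂; subst)
open import Relation.Nullary using (¬_)

------------------------------------------------------------------------
-- Real numbers: Cauchy sequences of rationals, with the usual equality,
-- strict order and (pointwise) ring operations.

IsCauchy : (ℕ → ℚ) → Set
IsCauchy x = ∀ ε → 0ℚ ℚ.< ε →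
  ∃[ N ] (∀ m n → N ℕ.≤ m → N ℕ.≤ n → ∣ x m ℚ.- x n ∣ ℚ.< ε)

record ℝ : Set where
  constructor mkℝ
  field
    seq    : ℕ → ℚ
    cauchy : IsCauchy seq

open ℝ public

infix 4 _≃_ _<_

record _≃_ (x y : ℝ) : Set where
  constructor mk≃
  field
    close : ∀ ε → 0ℚ ℚ.< ε →
      ∃[ N ] (∀ n → N ℕ.≤ n → ∣ seq x n ℚ.- seq y n ∣ ℚ.< ε)

-- A gap bounded below is needed: eventual termwise _<_ would relate some
-- sequences with the same limit.
record _<_ (x y : ℝ) : Set where
  constructor mk<
  field
    gap     : ℚ
    gap-pos : 0ℚ ℚ.< gap
    start   : ℕ
    below   : ∀ n → start ℕ.≤ n → seq x n ℚ.+ gap ℚ.< seq y n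

private
  half-pos : ∀ {ε} → 0ℚ ℚ.< ε → 0ℚ ℚ.< ½ ℚ.* ε
  half-pos {ε} 0<ε =
    subst (ℚ._< ½ ℚ.* ε) (ℚₚ.*-zeroʳ ½) (ℚₚ.*-monoʳ-<-pos ½ 0<ε)

  halves : ∀ ε → ½ ℚ.* ε ℚ.+ ½ ℚ.* ε ≡ ε
  halves ε = trans (sym (ℚₚ.*-distribʳ-+ ε ½ ½)) (ℚₚ.*-identityˡ ε)

  const-cauchy : ∀ q → IsCauchy (λ _ → q)
  const-cauchy q ε 0<ε = 0 , λ _ _ _ _ →
    subst (ℚ._< ε) (sym (cong ∣_∣ (ℚₚ.+-inverseʳ q))) 0<ε

  +-cauchy : ∀ x y → IsCauchy x → IsCauchy y →
             IsCauchy (λ n → x n ℚ.+ y n)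
  +-cauchy x y cx cy ε 0<ε
    with cx (½ ℚ.* ε) (half-pos 0<ε) | cy (½ ℚ.* ε) (half-pos 0<ε)
  ... | M , p | N , q = M ℕ.⊔ N , λ m n m≥ n≥ → begin-strict
      ∣ (x m ℚ.+ y m) ℚ.- (x n ℚ.+ y n) ∣
        ≡⟨ cong ∣_∣ (regroup (x m) (y m) (x n) (y n)) ⟩
      ∣ (x m ℚ.- x n) ℚ.+ (y m ℚ.- y n) ∣
        ≤⟨ ℚₚ.∣p+q∣≤∣p∣+∣q∣ (x m ℚ.- x n) (y m ℚ.- y n) ⟩
      ∣ x m ℚ.- x n ∣ ℚ.+ ∣ y m ℚ.- y n ∣
        <⟨ ℚₚ.+-mono-<
             (p m n (ℕₚ.m⊔n≤o⇒m≤o M N m≥) (ℕₚ.m⊔n≤o⇒m≤o M N n≥))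
             (q m n (ℕₚ.m⊔n≤o⇒n≤o M N m≥) (ℕₚ.m⊔n≤o⇒n≤o M N n≥)) ⟩
      ½ ℚ.* ε ℚ.+ ½ ℚ.* ε
        ≡⟨ halves ε ⟩
      ε ∎
    where
    open ≤-Reasoning
    open +-*-Solver
    regroup : ∀ a b c d →
      (a ℚ.+ b) ℚ.- (c ℚ.+ d) ≡ (a ℚ.- c) ℚ.+ (b ℚ.- d)
    regroup = solve 4 (λ a b c d →
      (a :+ b) :- (c :+ d) := (a :- c) :+ (b :- d)) refl

  neg-cauchy : ∀ x → IsCauchy x → IsCauchy (λ n → ℚ.- x n)
  neg-cauchy x cx ε 0<ε with cx ε 0<ε
  ... | N , p = N , λ m n m≥ n≥ →
      subst (ℚ._< ε) (cong ∣_∣ (flip (x m) (x n))) (p n m n≥ m≥)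
    where
    open +-*-Solver
    flip : ∀ a b → b ℚ.- a ≡ (ℚ.- a) ℚ.- (ℚ.- b)
    flip = solve 2 (λ a b → b :- a := (:- a) :- (:- b)) refl

  bounded : ∀ x → IsCauchy x →
    ∃[ B ] 0ℚ ℚ.< B × (∃[ N ] (∀ n → N ℕ.≤ n → ∣ x n ∣ ℚ.≤ B))
  bounded x cx with cx 1ℚ (ℚₚ.positive⁻¹ 1ℚ)
  ... | N , p = 1ℚ ℚ.+ ∣ x N ∣
              , ℚₚ.+-mono-<-≤ (ℚₚ.positive⁻¹ 1ℚ) (ℚₚ.0≤∣p∣ (x N))
              , N , λ n n≥ → begin
      ∣ x n ∣
        ≡⟨ cong ∣_∣ (split (x n) (x N)) ⟩
      ∣ (x n ℚ.- x N) ℚ.+ x N ∣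
        ≤⟨ ℚₚ.∣p+q∣≤∣p∣+∣q∣ (x n ℚ.- x N) (x N) ⟩
      ∣ x n ℚ.- x N ∣ ℚ.+ ∣ x N ∣
        ≤⟨ ℚₚ.+-monoˡ-≤ ∣ x N ∣ (ℚₚ.<⇒≤ (p n N n≥ ℕₚ.≤-refl)) ⟩
      1ℚ ℚ.+ ∣ x N ∣ ∎
    where
    open ≤-Reasoning
    open +-*-Solver
    split : ∀ a b → a ≡ (a ℚ.- b) ℚ.+ b
    split = solve 2 (λ a b → a := (a :- b) :+ b) refl

  shrink : ∀ {B ε} → 0ℚ ℚ.< B → 0ℚ ℚ.< ε →
           ∃[ δ ] 0ℚ ℚ.< δ × B ℚ.* δ ≡ ε
  shrink {B} {ε} 0<B 0<ε = 1/B ℚ.* ε , 0<δ , eq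
    where
    instance
      posB : ℚ.Positive B
      posB = ℚ.positive 0<B
      nzB : ℚ.NonZero B
      nzB = ℚₚ.pos⇒nonZero B
    1/B : ℚ
    1/B = 1/ B
    instance
      pos1/B : ℚ.Positive 1/B
      pos1/B = ℚₚ.1/pos⇒pos B
    0<δ : 0ℚ ℚ.< 1/B ℚ.* ε
    0<δ = subst (ℚ._< 1/B ℚ.* ε) (ℚₚ.*-zeroʳ 1/B) (ℚₚ.*-monoʳ-<-pos 1/B 0<ε)
    eq : B ℚ.* (1/B ℚ.* ε) ≡ ε
    eq = trans (sym (ℚₚ.*-assoc B 1/B ε))
        (trans (cong (ℚ._* ε) (ℚₚ.*-inverseʳ B)) (ℚₚ.*-identityˡ ε))

  *-bound : ∀ {B δ} p q → 0ℚ ℚ.< B → ∣ p ∣ ℚ.≤ B → ∣ q ∣ ℚ.< δ →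
            ∣ p ℚ.* q ∣ ℚ.< B ℚ.* δ
  *-bound {B} {δ} p q 0<B p≤B q<δ = begin-strict
      ∣ p ℚ.* q ∣      ≡⟨ ℚₚ.∣p*q∣≡∣p∣*∣q∣ p q ⟩
      ∣ p ∣ ℚ.* ∣ q ∣  ≤⟨ ℚₚ.*-monoʳ-≤-nonNeg ∣ q ∣ p≤B ⟩
      B ℚ.* ∣ q ∣      <⟨ ℚₚ.*-monoʳ-<-pos B q<δ ⟩
      B ℚ.* δ ∎
    where
    open ≤-Reasoning
    instance
      posB : ℚ.Positive B
      posB = ℚ.positive 0<B
      nn : ℚ.NonNegative ∣ q ∣
      nn = ℚₚ.∣-∣-nonNeg q

  *-close : ∀ {B C δ η} a b c d → 0ℚ ℚ.< B → 0ℚ ℚ.< C →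
            ∣ a ∣ ℚ.≤ B → ∣ d ∣ ℚ.≤ C →
            ∣ b ℚ.- d ∣ ℚ.< η → ∣ a ℚ.- c ∣ ℚ.< δ →
            ∣ a ℚ.* b ℚ.- c ℚ.* d ∣ ℚ.< B ℚ.* η ℚ.+ C ℚ.* δ
  *-close {B} {C} {δ} {η} a b c d 0<B 0<C a≤B d≤C b-d<η a-c<δ = begin-strict
      ∣ a ℚ.* b ℚ.- c ℚ.* d ∣
        ≡⟨ cong ∣_∣ (regroup a b c d) ⟩
      ∣ a ℚ.* (b ℚ.- d) ℚ.+ d ℚ.* (a ℚ.- c) ∣
        ≤⟨ ℚₚ.∣p+q∣≤∣p∣+∣q∣ (a ℚ.* (b ℚ.- d)) (d ℚ.* (a ℚ.- c)) ⟩
      ∣ a ℚ.* (b ℚ.- d) ∣ ℚ.+ ∣ d ℚ.* (a ℚ.- c) ∣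
        <⟨ ℚₚ.+-mono-< (*-bound a (b ℚ.- d) 0<B a≤B b-d<η)
                       (*-bound d (a ℚ.- c) 0<C d≤C a-c<δ) ⟩
      B ℚ.* η ℚ.+ C ℚ.* δ ∎
    where
    open ≤-Reasoning
    open +-*-Solver
    regroup : ∀ a b c d →
      a ℚ.* b ℚ.- c ℚ.* d ≡ a ℚ.* (b ℚ.- d) ℚ.+ d ℚ.* (a ℚ.- c)
    regroup = solve 4 (λ a b c d →
      a :* b :- c :* d := a :* (b :- d) :+ d :* (a :- c)) refl

  *-cauchy : ∀ x y → IsCauchy x → IsCauchy y →
             IsCauchy (λ n → x n ℚ.* y n)
  *-cauchy x y cx cy ε 0<ε =
    let B , 0<B , M₁ , x≤B = bounded x cx
        C , 0<C , N₁ , y≤C = bounded y cy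
        δ , 0<δ , Cδ = shrink 0<C (half-pos 0<ε)
        η , 0<η , Bη = shrink 0<B (half-pos 0<ε)
        M₂ , p = cx δ 0<δ
        N₂ , q = cy η 0<η
        total : B ℚ.* η ℚ.+ C ℚ.* δ ≡ ε
        total = trans (cong₂ ℚ._+_ Bη Cδ) (halves ε)
        M = M₁ ℕ.⊔ N₁
        N = M₂ ℕ.⊔ N₂
    in M ℕ.⊔ N , λ m n m≥ n≥ →
      let m≥M = ℕₚ.m⊔n≤o⇒m≤o M N m≥
          m≥N = ℕₚ.m⊔n≤o⇒n≤o M N m≥
          n≥M = ℕₚ.m⊔n≤o⇒m≤o M N n≥
          n≥N = ℕₚ.m⊔n≤o⇒n≤o M N n≥
      in subst (∣ x m ℚ.* y m ℚ.- x n ℚ.* y n ∣ ℚ.<_) total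
           (*-close (x m) (y m) (x n) (y n) 0<B 0<C
             (x≤B m (ℕₚ.m⊔n≤o⇒m≤o M₁ N₁ m≥M))
             (y≤C n (ℕₚ.m⊔n≤o⇒n≤o M₁ N₁ n≥M))
             (q m n (ℕₚ.m⊔n≤o⇒n≤o M₂ N₂ m≥N) (ℕₚ.m⊔n≤o⇒n≤o M₂ N₂ n≥N))
             (p m n (ℕₚ.m⊔n≤o⇒m≤o M₂ N₂ m≥N) (ℕₚ.m⊔n≤o⇒m≤o M₂ N₂ n≥N)))

infixl 6 _+_ _-_
infixl 7 _*_
infix  8 -_
infix  9 _² _³

fromℚ : ℚ → ℝ
fromℚ q = mkℝ (λ _ → q) (const-cauchy q)

fromℤ : ℤ → ℝ
fromℤ k = fromℚ (k ℚ./ 1)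

_+_ : ℝ → ℝ → ℝ
x + y = mkℝ (λ n → seq x n ℚ.+ seq y n) (+-cauchy (seq x) (seq y) (cauchy x) (cauchy y))

-_ : ℝ → ℝ
- x = mkℝ (λ n → ℚ.- seq x n) (neg-cauchy (seq x) (cauchy x))

_-_ : ℝ → ℝ → ℝ
x - y = x + - y

_*_ : ℝ → ℝ → ℝ
x * y = mkℝ (λ n → seq x n ℚ.* seq y n) (*-cauchy (seq x) (seq y) (cauchy x) (cauchy y))

_² : ℝ → ℝ
x ² = x * x

_³ : ℝ → ℝ
x ³ = x * x * x

IsRoot : ℤ → ℝ → Set
IsRoot a x =
  x ³ - fromℤ a * x ² - fromℤ (a ℤ.+ + 3) * x - fromℤ (+ 1) ≃ fromℤ (+ 0)

HasSign : Sign → ℝ → Set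
HasSign Sign.+ x = fromℤ (+ 0) < x
HasSign Sign.- x = x < fromℤ (+ 0)

Signature : Set
Signature = Sign × Sign × Sign

------------------------------------------------------------------------
-- ⟨ p , q , r ⟩ stands for p + qρ + rρ².  The defining cubic is monic and
-- irreducible, so 1, ρ, ρ² is a ℤ-basis of ℤ[ρ], and _≡_ on coordinates is
-- equality of numbers.

infix 5 ⟨_,_,_⟩

record ℤ[ρ] : Set where
  constructor ⟨_,_,_⟩
  field
    c₀ c₁ c₂ : ℤ

module SimplestCubic (a : ℤ) (ρ ρ′ ρ″ : ℝ) where

  infixl 6 _⊕_
  infixl 7 _⊗_
  infix  4 _≻_ _⪰_

  _⊕_ : ℤ[ρ] → ℤ[ρ] → ℤ[ρ]
  ⟨ p , q , r ⟩ ⊕ ⟨ s , t , u ⟩ = ⟨ p ℤ.+ s , q ℤ.+ t , r ℤ.+ u ⟩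

  scale : ℤ → ℤ[ρ] → ℤ[ρ]
  scale k ⟨ p , q , r ⟩ = ⟨ k ℤ.* p , k ℤ.* q , k ℤ.* r ⟩

  -- ρ (p + qρ + rρ²), reduced by ρ³ = aρ² + (a + 3)ρ + 1.
  ρ· : ℤ[ρ] → ℤ[ρ]
  ρ· ⟨ p , q , r ⟩ = ⟨ r , p ℤ.+ (a ℤ.+ + 3) ℤ.* r , q ℤ.+ a ℤ.* r ⟩

  _⊗_ : ℤ[ρ] → ℤ[ρ] → ℤ[ρ]
  ⟨ p , q , r ⟩ ⊗ β = scale p β ⊕ scale q (ρ· β) ⊕ scale r (ρ· (ρ· β))

  IsUnit : ℤ[ρ] → Set
  IsUnit α = ∃[ β ] α ⊗ β ≡ ⟨ + 1 , + 0 , + 0 ⟩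

  evalAt : ℝ → ℤ[ρ] → ℝ
  evalAt x ⟨ p , q , r ⟩ = fromℤ p + fromℤ q * x + fromℤ r * x ²

  -- The real numbers α, α′ and α″: the ℚ-isomorphisms ρ ↦ ρ′ and ρ ↦ ρ″ fix
  -- the coordinates, so each image is found by substituting the conjugate.
  real conj′ conj″ : ℤ[ρ] → ℝ
  real  = evalAt ρ
  conj′ = evalAt ρ′
  conj″ = evalAt ρ″

  HasSignature : Signature → ℤ[ρ] → Set
  HasSignature (s , s′ , s″) α =
    HasSign s (real α) × HasSign s′ (conj′ α) × HasSign s″ (conj″ α)

  Indecomposable : Signature → ℤ[ρ] → Set
  Indecomposable σ α = HasSignature σ α ×
    ¬ (∃[ β₁ ] ∃[ β₂ ] HasSignature σ β₁ × HasSignature σ β₂ × α ≡ β₁ ⊕ β₂)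

  _≻_ : ℤ[ρ] → ℤ[ρ] → Set
  α ≻ β = real β < real α × conj′ β < conj′ α × conj″ β < conj″ α

  _⪰_ : ℤ[ρ] → ℤ[ρ] → Set
  α ⪰ β = α ≻ β ⊎ α ≡ β

  γ : ℤ[ρ]
  γ = ⟨ a ℤ.* a ℤ.+ a ℤ.+ + 8 , a ℤ.* a ℤ.- a ℤ.+ + 1 , + 2 ℤ.- a ⟩

  -- α is the element δ, and δ equals the given product of conjugates as a
  -- real number.
  _is_equalTo_ : ℤ[ρ] → ℤ[ρ] → ℝ → Set
  α is δ equalTo x = α ≡ δ × x ≃ real δ

-- Write β = x + yρ + zρ′; the basis 1, ρ, ρ′ is adapted to the sizes of the conjugates of β.  The
-- values of γ at ρ, ρ′, ρ″ are less than (a + 2)², (3 − ρ″)², (a + 1)², so γ ⪰ β² gives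
-- |β| < a + 2, |β′| < 3 − ρ″ and |β″| < a + 1.  Solving for y and z by Cramer's rule yields
-- |y|, |z| ≤ 1, after which x is confined to a few values: up to sign β is one of 0, 1, 2, 3, ρ,
-- ρ − 1, ρ′ − 1, ρ′ − 2, ρ + ρ′ − 1.  Of these 0 has no signature, 1 and ρ are units, and 2 and 3
-- are decomposable; the squares of the other four are the listed elements, because ρρ′ρ″ = 1.

module Submission where

open import Algebra.Bundles using (CommutativeRing)
import Algebra.Consequences.Setoid
import Algebra.Properties.Ring as RingProperties
import Algebra.Solver.Ring
open import Algebra.Solver.Ring.AlmostCommutativeRing
  using (fromCommutativeRing; _-Raw-AlmostCommutative⟶_)
open import Data.Empty using (⊥-elim)
open import Data.Integer as ℤ using (ℤ; +_; -[1+_])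
import Data.Integer.Properties as ℤₚ
import Data.Integer.Solver as ℤ-Solver
import Data.Maybe as Maybe
open import Data.Nat as ℕ using (ℕ; zero; suc)
import Data.Nat.Properties as ℕₚ
open import Data.Product using (∃-syntax; _×_; _,_; proj₁; proj₂)
open import Data.Rational as ℚ using (ℚ; 0ℚ; 1ℚ; ½; ∣_∣; 1/_)
open import Data.Rational.Properties as ℚₚ using (module ≤-Reasoning)
open import Data.Rational.Solver using (module +-*-Solver)
import Data.Rational.Unnormalised as ℚᵘ
import Data.Rational.Unnormalised.Properties as ℚᵘₚ
open import Data.Sign as Sign using (Sign)
open import Data.Sum using (_⊎_; inj₁; inj₂; [_,_]′)
open import Function using (case_of_)
open import Level using (0ℓ)
open import Relation.Binary.Bundles using (Setoid)
open import Relation.Binary.PropositionalEquality as ≡ using (_≡_; cong; cong₂; subst; subst₂)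
open import Relation.Binary.Structures using (IsEquivalence)
open import Relation.Nullary using (¬_)
open import Relation.Nullary.Decidable using (dec⇒maybe)

open import Defs using (ℤ[ρ]; ⟨_,_,_⟩)

-- Comparison of Cauchy reals is not decidable, so no estimate splits on a sign. Every inequality is
-- a certificate instead: a ring identity that writes the quantity as a sum of products of positive
-- terms plus a combination of expressions known to vanish. All of them live in A = a, s = -1 - ρ′
-- and t = -ρ″. The vanishing expressions come from ρs = 1 and (ρ + 1)t = 1, and a ≥ 15 enters
-- through the positive quantity A - 14, in terms of which the coefficients come out positive. The
-- two relations have to be earned: the roots are given separately, by intervals, and only the
-- intervals decide that ρ′ is -1 - 1/ρ while ρ″ is -1/(1 + ρ). The delicate bound is the one at ρ′.
-- There γ takes a value slightly above 9, so 3 - ρ″ cannot be rounded down to 3; but 3 - ρ″ is also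
-- the absolute value of the conjugate ρ″ - 3 of ρ′ - 3, and that is why ρ′ - 3 is excluded while ρ′
-- - 2 survives.

module _ where
  open ℤ-Solver.+-*-Solver
  open ≡ using (refl)
  open import Data.Integer using (_+_; _*_; _-_; -_)

  triple≡ : ∀ {p p′ q q′ r r′} → p ≡ p′ → q ≡ q′ → r ≡ r′ → ⟨ p , q , r ⟩ ≡ ⟨ p′ , q′ , r′ ⟩
  triple≡ refl refl refl = refl

  ⊖_ : ℤ[ρ] → ℤ[ρ]
  ⊖ ⟨ p , q , r ⟩ = ⟨ - p , - q , - r ⟩

  -- Multiplication in ℤ[ρ] and the basis 1, ρ, ρ′, by integer identities alone.

  module Coordinates (a : ℤ) where

    -- This is `_⊗_` with its nested reductions written out. It mentions no real number, so
    -- equalities of products become polynomial identities over the integers.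
    times : ℤ[ρ] → ℤ[ρ] → ℤ[ρ]
    times ⟨ p , q , r ⟩ ⟨ s , t , u ⟩ =
      ⟨ p * s + q * u + r * (t + a * u)
      , p * t + q * (s + (a + + 3) * u) + r * (u + (a + + 3) * (t + a * u))
      , p * u + q * (t + a * u) + r * (s + (a + + 3) * u + a * (t + a * u)) ⟩

    private
      -- Copies of the coordinates of `times` in the syntax of the solver, so that the goals below
      -- can be quoted without being expanded by hand.
      times₀ times₁ times₂ : ∀ {n} (a p q r s t u : Polynomial n) → Polynomial n
      times₀ a p q r s t u = p :* s :+ q :* u :+ r :* (t :+ a :* u)
      times₁ a p q r s t u = p :* t :+ q :* (s :+ (a :+ con (+ 3)) :* u)
        :+ r :* (u :+ (a :+ con (+ 3)) :* (t :+ a :* u))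
      times₂ a p q r s t u = p :* u :+ q :* (t :+ a :* u)
        :+ r :* (s :+ (a :+ con (+ 3)) :* u :+ a :* (t :+ a :* u))

    -- x + yρ + zρ′, by ρ′ = a + 2 + aρ − ρ².
    embed : ℤ → ℤ → ℤ → ℤ[ρ]
    embed x y z = ⟨ x + (a + + 2) * z , y + a * z , - z ⟩

    -- The coefficient of ρ² in ρ′ is -1, so the change of basis is unimodular and needs no
    -- denominators.
    embed-surjective : ∀ α → ∃[ x ] ∃[ y ] ∃[ z ] α ≡ embed x y z
    embed-surjective ⟨ p , q , r ⟩ = p + (a + + 2) * r , q + a * r , - r , triple≡
      (solve 3 (λ a p r → p := p :+ (a :+ con (+ 2)) :* r :+ (a :+ con (+ 2)) :* (:- r)) refl a p r)
      (solve 3 (λ a q r → q := q :+ a :* r :+ a :* (:- r)) refl a q r)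
      (solve 1 (λ r → r := :- (:- r)) refl r)

    ⊖-embed : ∀ x y z → embed x y z ≡ ⊖ embed (- x) (- y) (- z)
    ⊖-embed x y z = triple≡
      (solve 3 (λ a x z → x :+ (a :+ con (+ 2)) :* z
        := :- (:- x :+ (a :+ con (+ 2)) :* (:- z))) refl a x z)
      (solve 3 (λ a y z → y :+ a :* z := :- (:- y :+ a :* (:- z))) refl a y z)
      (solve 1 (λ z → :- z := :- (:- (:- z))) refl z)

    private
      embed₀ embed₁ embed₂ : ∀ {n} (a : Polynomial n) → ℤ → ℤ → ℤ → Polynomial n
      embed₀ a x y z = con x :+ (a :+ con (+ 2)) :* con z
      embed₁ a x y z = con y :+ a :* con z
      embed₂ a x y z = con (- z)

      square₀ square₁ square₂ : ∀ {n} (a : Polynomial n) → ℤ → ℤ → ℤ → Polynomial n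
      square₀ a x y z = let p = embed₀ a x y z; q = embed₁ a x y z; r = embed₂ a x y z in
        times₀ a p q r p q r
      square₁ a x y z = let p = embed₀ a x y z; q = embed₁ a x y z; r = embed₂ a x y z in
        times₁ a p q r p q r
      square₂ a x y z = let p = embed₀ a x y z; q = embed₁ a x y z; r = embed₂ a x y z in
        times₂ a p q r p q r

    -- In the new basis all coefficients of γ are linear in a, which makes the sizes of its three
    -- conjugates visible.
    γ-embed : ⟨ a * a + a + + 8 , a * a - a + + 1 , + 2 - a ⟩ ≡ embed (a + + 12) (a + + 1) (a - + 2)
    γ-embed = triple≡
      (solve 1 (λ a → a :* a :+ a :+ con (+ 8)
        := a :+ con (+ 12) :+ (a :+ con (+ 2)) :* (a :- con (+ 2))) refl a)
      (solve 1 (λ a → a :* a :- a :+ con (+ 1)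
        := a :+ con (+ 1) :+ a :* (a :- con (+ 2))) refl a)
      (solve 1 (λ a → con (+ 2) :- a := :- (a :- con (+ 2))) refl a)

    [ρ-1]² : times (embed -[1+ 0 ] (+ 1) (+ 0)) (embed -[1+ 0 ] (+ 1) (+ 0))
             ≡ ⟨ + 1 , - (+ 2) , + 1 ⟩
    [ρ-1]² = triple≡
      (solve 1 (λ a → square₀ a -[1+ 0 ] (+ 1) (+ 0) := con (+ 1)) refl a)
      (solve 1 (λ a → square₁ a -[1+ 0 ] (+ 1) (+ 0) := con (- (+ 2))) refl a)
      (solve 1 (λ a → square₂ a -[1+ 0 ] (+ 1) (+ 0) := con (+ 1)) refl a)

    [ρ′-1]² : times (embed -[1+ 0 ] (+ 0) (+ 1)) (embed -[1+ 0 ] (+ 0) (+ 1))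
              ≡ ⟨ a * a + a + + 1 , a * a - a + + 1 , - (a - + 1) ⟩
    [ρ′-1]² = triple≡
      (solve 1 (λ a → square₀ a -[1+ 0 ] (+ 0) (+ 1) := a :* a :+ a :+ con (+ 1)) refl a)
      (solve 1 (λ a → square₁ a -[1+ 0 ] (+ 0) (+ 1) := a :* a :- a :+ con (+ 1)) refl a)
      (solve 1 (λ a → square₂ a -[1+ 0 ] (+ 0) (+ 1) := :- (a :- con (+ 1))) refl a)

    [ρ′-2]² : times (embed -[1+ 1 ] (+ 0) (+ 1)) (embed -[1+ 1 ] (+ 0) (+ 1))
              ≡ ⟨ a * a - a , a * a - + 3 * a + + 1 , - (a - + 3) ⟩
    [ρ′-2]² = triple≡
      (solve 1 (λ a → square₀ a -[1+ 1 ] (+ 0) (+ 1) := a :* a :- a) refl a)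
      (solve 1 (λ a → square₁ a -[1+ 1 ] (+ 0) (+ 1)
        := a :* a :- con (+ 3) :* a :+ con (+ 1)) refl a)
      (solve 1 (λ a → square₂ a -[1+ 1 ] (+ 0) (+ 1) := :- (a :- con (+ 3))) refl a)

    [ρ+ρ′-1]² : times (embed -[1+ 0 ] (+ 1) (+ 1)) (embed -[1+ 0 ] (+ 1) (+ 1))
                ≡ ⟨ a * a + a - + 1 , a * a - a - + 3 , - (a - + 2) ⟩
    [ρ+ρ′-1]² = triple≡
      (solve 1 (λ a → square₀ a -[1+ 0 ] (+ 1) (+ 1) := a :* a :+ a :- con (+ 1)) refl a)
      (solve 1 (λ a → square₁ a -[1+ 0 ] (+ 1) (+ 1) := a :* a :- a :- con (+ 3)) refl a)
      (solve 1 (λ a → square₂ a -[1+ 0 ] (+ 1) (+ 1) := :- (a :- con (+ 2))) refl a)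

    embed-rational : ∀ x → embed x (+ 0) (+ 0) ≡ ⟨ x , + 0 , + 0 ⟩
    embed-rational x = triple≡
      (solve 2 (λ a x → x :+ (a :+ con (+ 2)) :* con (+ 0) := x) refl a x)
      (solve 1 (λ a → con (+ 0) :+ a :* con (+ 0) := con (+ 0)) refl a)
      refl

    times-rational : ∀ x y → times ⟨ x , + 0 , + 0 ⟩ ⟨ y , + 0 , + 0 ⟩ ≡ ⟨ x * y , + 0 , + 0 ⟩
    times-rational x y = triple≡
      (solve 3 (λ a x y → times₀ a x 0ᵖ 0ᵖ y 0ᵖ 0ᵖ := x :* y) refl a x y)
      (solve 3 (λ a x y → times₁ a x 0ᵖ 0ᵖ y 0ᵖ 0ᵖ := 0ᵖ) refl a x y)
      (solve 3 (λ a x y → times₂ a x 0ᵖ 0ᵖ y 0ᵖ 0ᵖ := 0ᵖ) refl a x y)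
      where
      0ᵖ : ∀ {n} → Polynomial n
      0ᵖ = con (+ 0)

    -- The constant term of the cubic is -1, so the equation reads ρ(ρ² - aρ - (a + 3)) = 1.
    ρ⁻¹ : ℤ[ρ]
    ρ⁻¹ = ⟨ - (a + + 3) , - a , + 1 ⟩

    ρ-inverse : times (embed (+ 0) (+ 1) (+ 0)) ρ⁻¹ ≡ ⟨ + 1 , + 0 , + 0 ⟩
    ρ-inverse = triple≡
      (solve 1 (λ a → times₀ a (e₀ a) (e₁ a) 0ᵖ (i₀ a) (:- a) (con (+ 1)) := con (+ 1)) refl a)
      (solve 1 (λ a → times₁ a (e₀ a) (e₁ a) 0ᵖ (i₀ a) (:- a) (con (+ 1)) := 0ᵖ) refl a)
      (solve 1 (λ a → times₂ a (e₀ a) (e₁ a) 0ᵖ (i₀ a) (:- a) (con (+ 1)) := 0ᵖ) refl a)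
      where
      e₀ e₁ i₀ : ∀ {n} → Polynomial n → Polynomial n
      e₀ a = embed₀ a (+ 0) (+ 1) (+ 0)
      e₁ a = embed₁ a (+ 0) (+ 1) (+ 0)
      i₀ a = :- (a :+ con (+ 3))
      0ᵖ : ∀ {n} → Polynomial n
      0ᵖ = con (+ 0)

    ⊖-times : ∀ α β → times (⊖ α) (⊖ β) ≡ times α β
    ⊖-times ⟨ p , q , r ⟩ ⟨ s , t , u ⟩ = triple≡
      (solve 7 (λ a p q r s t u → times₀ a (:- p) (:- q) (:- r) (:- s) (:- t) (:- u)
        := times₀ a p q r s t u) refl a p q r s t u)
      (solve 7 (λ a p q r s t u → times₁ a (:- p) (:- q) (:- r) (:- s) (:- t) (:- u)
        := times₁ a p q r s t u) refl a p q r s t u)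
      (solve 7 (λ a p q r s t u → times₂ a (:- p) (:- q) (:- r) (:- s) (:- t) (:- u)
        := times₂ a p q r s t u) refl a p q r s t u)

-- Up to sign, the triples (x, y, z) for which x + yρ + zρ′ is within the bounds given by γ.
data Candidate : ℤ → ℤ → ℤ → Set where
  rational     : ∀ {x} → x ℤ.< + 4 → -[1+ 3 ] ℤ.< x → Candidate x (+ 0) (+ 0)
  [ρ]          : Candidate (+ 0) (+ 1) (+ 0)
  [ρ-1]        : Candidate -[1+ 0 ] (+ 1) (+ 0)
  [ρ′-1]       : Candidate -[1+ 0 ] (+ 0) (+ 1)
  [ρ′-2]       : Candidate -[1+ 1 ] (+ 0) (+ 1)
  [ρ+ρ′-1]     : Candidate -[1+ 0 ] (+ 1) (+ 1)

-- The properties of the reals on which the estimates rest, and positivity certificates.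

record OrderedRing : Set₁ where
  field
    commutativeRing : CommutativeRing 0ℓ 0ℓ
  open CommutativeRing commutativeRing
  field
    ι          : ℤ → Carrier
    ι-+        : ∀ m n → ι (m ℤ.+ n) ≈ ι m + ι n
    ι-*        : ∀ m n → ι (m ℤ.* n) ≈ ι m * ι n
    ι-0        : ι (+ 0) ≈ 0#
    ι-1        : ι (+ 1) ≈ 1#
    Pos        : Carrier → Set
    pos-resp   : ∀ {x y} → x ≈ y → Pos x → Pos y
    pos-+      : ∀ {x y} → Pos x → Pos y → Pos (x + y)
    pos-*      : ∀ {x y} → Pos x → Pos y → Pos (x * y)
    -- There is no weak order in this interface, and a square whose root has unknown sign is not
    -- known to be positive. Added to something positive it is harmless.
    pos-+-²    : ∀ {x} y → Pos x → Pos (x + y * y)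
    pos-1      : Pos (ι (+ 1))
    pos-irrefl : ¬ Pos (ι (+ 0))
    -- This law and the next stand in for division by a positive element.
    pos-cancel : ∀ {x y} → Pos x → Pos (x * y) → Pos y
    ≈0-cancel  : ∀ {x y} → Pos x → x * y ≈ ι (+ 0) → y ≈ ι (+ 0)

module OrderedRingProperties (O : OrderedRing) where
  open OrderedRing O public
  open CommutativeRing commutativeRing public
  open RingProperties ring using (+-inverseˡ-unique)

  ι-neg : ∀ m → ι (ℤ.- m) ≈ - ι m
  ι-neg m = +-inverseˡ-unique (ι (ℤ.- m)) (ι m)
    (trans (sym (ι-+ (ℤ.- m) m)) (trans (reflexive (cong ι (ℤₚ.+-inverseˡ m))) ι-0))

  ι-homomorphism : CommutativeRing.rawRing ℤₚ.+-*-commutativeRing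
                     -Raw-AlmostCommutative⟶ fromCommutativeRing commutativeRing
  ι-homomorphism = record
    { ⟦_⟧ = ι ; +-homo = ι-+ ; *-homo = ι-* ; -‿homo = ι-neg ; 0-homo = ι-0 ; 1-homo = ι-1 }

  -- Integer coefficients have decidable equality, which the carrier does not, so polynomials can be
  -- normalised with numerals collected.
  open Algebra.Solver.Ring (CommutativeRing.rawRing ℤₚ.+-*-commutativeRing)
    (fromCommutativeRing commutativeRing) ι-homomorphism
    (λ m n → Maybe.map (λ eq → reflexive (cong ι eq)) (dec⇒maybe (m ℤ.≟ n))) public
    using (con; solve; _:=_; _:+_; _:*_; _:-_; :-_)

  infixl 6 _+⁺_
  infixl 7 _*⁺_
  infix 9 _²

  _+⁺_ = pos-+
  _*⁺_ = pos-*

  _² : Carrier → Carrier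
  x ² = x * x

  pos-ι : ∀ n → Pos (ι (+ suc n))
  pos-ι zero    = pos-1
  pos-ι (suc n) = pos-resp (sym (ι-+ (+ 1) (+ suc n))) (pos-1 +⁺ pos-ι n)

  pos-ι⇒0< : ∀ m → Pos (ι m) → + 0 ℤ.< m
  pos-ι⇒0< (+ zero)  p = ⊥-elim (pos-irrefl p)
  pos-ι⇒0< (+ suc n) p = ℤ.+<+ (ℕ.s≤s ℕ.z≤n)
  pos-ι⇒0< -[1+ n ]  p = ⊥-elim (pos-irrefl (pos-resp
    (trans (sym (ι-+ -[1+ n ] (+ suc n))) (reflexive (cong ι (ℤₚ.+-inverseˡ (+ suc n)))))
    (p +⁺ pos-ι n)))

  -- The passage from estimates to finitely many cases: a strict inequality between embedded
  -- integers becomes one that pattern matching can exhaust.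
  ι-reflects-< : ∀ {m n} → Pos (ι n - ι m) → m ℤ.< n
  ι-reflects-< {m} {n} p = subst₂ ℤ._<_ (ℤₚ.+-identityˡ m) n-m+m≡n
    (ℤₚ.+-monoˡ-< m (pos-ι⇒0< (n ℤ.- m)
      (pos-resp (sym (trans (ι-+ n (ℤ.- m)) (+-congˡ (ι-neg m)))) p)))
    where
    n-m+m≡n : n ℤ.- m ℤ.+ m ≡ n
    n-m+m≡n = ≡.trans (ℤₚ.+-assoc n (ℤ.- m) m)
      (≡.trans (cong (λ k → n ℤ.+ k) (ℤₚ.+-inverseˡ m)) (ℤₚ.+-identityʳ n))

  0<⇒pos-ι : ∀ {m} → + 0 ℤ.< m → Pos (ι m)
  0<⇒pos-ι {+ suc n}  _           = pos-ι n
  0<⇒pos-ι {+ zero}   (ℤ.+<+ ())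
  0<⇒pos-ι { -[1+ n ]} ()

  ι-mono-< : ∀ {m n} → m ℤ.< n → Pos (ι n - ι m)
  ι-mono-< {m} {n} m<n = pos-resp (trans (ι-+ n (ℤ.- m)) (+-congˡ (ι-neg m)))
    (0<⇒pos-ι (subst (ℤ._< n ℤ.- m) (ℤₚ.+-inverseʳ m) (ℤₚ.+-monoˡ-< (ℤ.- m) m<n)))

  infixl 6 _+⁰_
  infixr 7 _*⁰_

  -- With `_*⁰_` and `-⁰_` this makes the vanishing expressions an ideal: a proof mirrors the
  -- right-hand side of an identity, with cofactors to the left of `*⁰`.
  _+⁰_ : ∀ {x y} → x ≈ ι (+ 0) → y ≈ ι (+ 0) → x + y ≈ ι (+ 0)
  p +⁰ q = trans (+-cong p q) (sym (ι-+ (+ 0) (+ 0)))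

  _*⁰_ : ∀ x {y} → y ≈ ι (+ 0) → x * y ≈ ι (+ 0)
  x *⁰ q = trans (*-congˡ (trans q ι-0)) (trans (zeroʳ x) (sym ι-0))

  -⁰_ : ∀ {x} → x ≈ ι (+ 0) → - x ≈ ι (+ 0)
  -⁰ p = trans (-‿cong p) (sym (ι-neg (+ 0)))

  -≈0⇒≈ : ∀ {x y} → x - y ≈ ι (+ 0) → x ≈ y
  -≈0⇒≈ {x} {y} p = trans (solve 2 (λ x y → x := x :- y :+ y) refl x y)
    (trans (+-congʳ (trans p ι-0)) (+-identityˡ y))

  ≈⇒-≈0 : ∀ {x y} → x ≈ y → x - y ≈ ι (+ 0)
  ≈⇒-≈0 {x} {y} p = trans (+-congʳ p) (trans (-‿inverseʳ y) (sym ι-0))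

  -- The shape of most certificates below: a visibly positive `p`, and a remainder `z` in the ideal
  -- of relations.
  pos-mod : ∀ {x p z} → x ≈ p + z → Pos p → z ≈ ι (+ 0) → Pos x
  pos-mod {x} {p} {z} eq pos z≈0 =
    pos-resp (sym (trans eq (trans (+-congˡ (trans z≈0 ι-0)) (+-identityʳ p)))) pos

  pos-trans : ∀ {x y z} → Pos (x - y) → Pos (y - z) → Pos (x - z)
  pos-trans {x} {y} {z} p q = pos-resp
    (solve 3 (λ x y z → x :- y :+ (y :- z) := x :- z) refl x y z) (p +⁺ q)

  -- Adding (B - b)² to B² - b² gives 2B(B - b), from which the positive factor 2B cancels. The sign
  -- of b is never consulted.
  sqrt-bound : ∀ {b B} → Pos B → Pos (B ² - b ²) → Pos (B - b)
  sqrt-bound {b} {B} pB p = pos-cancel (pos-ι 1 *⁺ pB)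
    (pos-resp
      (solve 2 (λ b B → B :* B :- b :* b :+ (B :- b) :* (B :- b)
                          := con (+ 2) :* B :* (B :- b)) refl b B)
      (pos-+-² (B - b) p))

  cubic : Carrier → Carrier → Carrier
  cubic A x = x * x * x - A * x ² - (A + ι (+ 3)) * x - ι (+ 1)

  -- Vieta's relations and the cyclic action, from the intervals of the three roots.

  module Relations {A ρ ρ′ ρ″ : Carrier}
    (root : cubic A ρ ≈ ι (+ 0)) (root′ : cubic A ρ′ ≈ ι (+ 0)) (root″ : cubic A ρ″ ≈ ι (+ 0))
    (A>0 : Pos A) (ρ>A+1 : Pos (ρ - (A + ι (+ 1))))
    (ρ′<-1 : Pos (- ι (+ 1) - ρ′)) (ρ″>-1 : Pos (ρ″ + ι (+ 1))) (ρ″<0 : Pos (- ρ″))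
    where

    private
      -- The divided difference of the cubic at x and y.
      quadratic : Carrier → Carrier → Carrier
      quadratic x y = x * x + x * y + y * y - A * (x + y) - (A + ι (+ 3))

      roots⇒quadratic : ∀ {x y} → cubic A x ≈ ι (+ 0) → cubic A y ≈ ι (+ 0) →
                        Pos (x - y) → quadratic x y ≈ ι (+ 0)
      roots⇒quadratic {x} {y} p q x>y = ≈0-cancel x>y (trans
        (solve 3 (λ A x y →
          (x :- y) :* (x :* x :+ x :* y :+ y :* y :- A :* (x :+ y) :- (A :+ con (+ 3)))
            := x :* x :* x :- A :* (x :* x) :- (A :+ con (+ 3)) :* x :- con (+ 1)
              :+ :- (y :* y :* y :- A :* (y :* y) :- (A :+ con (+ 3)) :* y :- con (+ 1)))
          refl A x y)
        (p +⁰ (-⁰ q)))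

      ρ>0 : Pos ρ
      ρ>0 = pos-resp (solve 2 (λ A ρ → ρ :- (A :+ con (+ 1)) :+ A :+ con (+ 1) := ρ) refl A ρ)
        (ρ>A+1 +⁺ A>0 +⁺ pos-ι 0)

      ρ>ρ′ : Pos (ρ - ρ′)
      ρ>ρ′ = pos-resp
        (solve 2 (λ ρ ρ′ → ρ :+ (:- con (+ 1) :- ρ′) :+ con (+ 1) := ρ :- ρ′) refl ρ ρ′)
        (ρ>0 +⁺ ρ′<-1 +⁺ pos-ι 0)

      ρ>ρ″ : Pos (ρ - ρ″)
      ρ>ρ″ = ρ>0 +⁺ ρ″<0

      ρ″>ρ′ : Pos (ρ″ - ρ′)
      ρ″>ρ′ = pos-resp
        (solve 2 (λ ρ′ ρ″ → ρ″ :+ con (+ 1) :+ (:- con (+ 1) :- ρ′) := ρ″ :- ρ′) refl ρ′ ρ″)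
        (ρ″>-1 +⁺ ρ′<-1)

      quadratic′ : quadratic ρ ρ′ ≈ ι (+ 0)
      quadratic′ = roots⇒quadratic root root′ ρ>ρ′

      quadratic″ : quadratic ρ ρ″ ≈ ι (+ 0)
      quadratic″ = roots⇒quadratic root root″ ρ>ρ″

      -- The second divided difference: subtracting the two quadratics leaves the factor ρ″ - ρ′,
      -- which is positive and cancels.
      trace : ρ + ρ′ + ρ″ - A ≈ ι (+ 0)
      trace = ≈0-cancel ρ″>ρ′ (trans
        (solve 4 (λ A ρ ρ′ ρ″ →
          (ρ″ :- ρ′) :* (ρ :+ ρ′ :+ ρ″ :- A)
            := ρ :* ρ :+ ρ :* ρ″ :+ ρ″ :* ρ″ :- A :* (ρ :+ ρ″) :- (A :+ con (+ 3))
              :+ :- (ρ :* ρ :+ ρ :* ρ′ :+ ρ′ :* ρ′ :- A :* (ρ :+ ρ′) :- (A :+ con (+ 3))))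
          refl A ρ ρ′ ρ″)
        (quadratic″ +⁰ (-⁰ quadratic′)))

      norm : ρ * ρ′ * ρ″ - ι (+ 1) ≈ ι (+ 0)
      norm = trans
        (solve 4 (λ A ρ ρ′ ρ″ →
          ρ :* ρ′ :* ρ″ :- con (+ 1)
            := ρ :* ρ :* ρ :- A :* (ρ :* ρ) :- (A :+ con (+ 3)) :* ρ :- con (+ 1)
              :+ ρ :* ρ′ :* (ρ :+ ρ′ :+ ρ″ :- A)
              :+ (:- ρ) :* (ρ :* ρ :+ ρ :* ρ′ :+ ρ′ :* ρ′ :- A :* (ρ :+ ρ′) :- (A :+ con (+ 3))))
          refl A ρ ρ′ ρ″)
        (root +⁰ (ρ * ρ′) *⁰ trace +⁰ (- ρ) *⁰ quadratic′)

      -- The other candidate for ρ′ is ρ″, for which this expression is positive.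
      ρρ′+ρ+1 : ρ * ρ′ + ρ + ι (+ 1) ≈ ι (+ 0)
      ρρ′+ρ+1 = ≈0-cancel (ρ>0 *⁺ ρ″>-1 +⁺ pos-ι 0) (trans
        (solve 4 (λ A ρ ρ′ ρ″ →
          (ρ :* (ρ″ :+ con (+ 1)) :+ con (+ 1)) :* (ρ :* ρ′ :+ ρ :+ con (+ 1))
            := ρ :* (ρ :* ρ′ :* ρ″ :- con (+ 1))
              :+ (ρ :* ρ :+ ρ) :* (ρ :+ ρ′ :+ ρ″ :- A)
              :+ :- (ρ :* ρ :* ρ :- A :* (ρ :* ρ) :- (A :+ con (+ 3)) :* ρ :- con (+ 1)))
          refl A ρ ρ′ ρ″)
        (ρ *⁰ norm +⁰ (ρ * ρ + ρ) *⁰ trace +⁰ (-⁰ root)))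


      ρρ″+ρ″+1 : ρ * ρ″ + ρ″ + ι (+ 1) ≈ ι (+ 0)
      ρρ″+ρ″+1 = trans
        (solve 3 (λ ρ ρ′ ρ″ →
          ρ :* ρ″ :+ ρ″ :+ con (+ 1)
            := :- (ρ :* ρ′ :* ρ″ :- con (+ 1)) :+ ρ″ :* (ρ :* ρ′ :+ ρ :+ con (+ 1)))
          refl ρ ρ′ ρ″)
        ((-⁰ norm) +⁰ ρ″ *⁰ ρρ′+ρ+1)

      ρ′ρ″+ρ′+1 : ρ′ * ρ″ + ρ′ + ι (+ 1) ≈ ι (+ 0)
      ρ′ρ″+ρ′+1 = trans
        (solve 3 (λ ρ ρ′ ρ″ →
          ρ′ :* ρ″ :+ ρ′ :+ con (+ 1)
            := ρ′ :* (ρ :* ρ″ :+ ρ″ :+ con (+ 1)) :+ :- (ρ :* ρ′ :* ρ″ :- con (+ 1)))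
          refl ρ ρ′ ρ″)
        (ρ′ *⁰ ρρ″+ρ″+1 +⁰ (-⁰ norm))

    ρρ′ρ″≈1 : ρ * ρ′ * ρ″ ≈ ι (+ 1)
    ρρ′ρ″≈1 = -≈0⇒≈ norm

    A-ρ″≈ρ+ρ′ : A - ρ″ ≈ ρ + ρ′
    A-ρ″≈ρ+ρ′ = sym (-≈0⇒≈ (trans
      (solve 4 (λ A ρ ρ′ ρ″ → ρ :+ ρ′ :- (A :- ρ″) := ρ :+ ρ′ :+ ρ″ :- A) refl A ρ ρ′ ρ″) trace))

    -- The polynomial a + 2 + aX - X² permutes the roots cyclically, ρ to ρ′ to ρ″ to ρ; this and
    -- the next two lemmas are its three steps. They give the value of x + yρ + zρ′ at each root as
    -- a linear form in the roots.
    next-ρ : A + ι (+ 2) + A * ρ - ρ ² ≈ ρ′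
    next-ρ = -≈0⇒≈ (trans
      (solve 4 (λ A ρ ρ′ ρ″ →
        A :+ con (+ 2) :+ A :* ρ :- ρ :* ρ :- ρ′
          := (ρ :* ρ′ :+ ρ :+ con (+ 1)) :+ (ρ :* ρ″ :+ ρ″ :+ con (+ 1))
            :+ (:- (con (+ 1) :+ ρ)) :* (ρ :+ ρ′ :+ ρ″ :- A))
        refl A ρ ρ′ ρ″)
      (ρρ′+ρ+1 +⁰ ρρ″+ρ″+1 +⁰ (- (ι (+ 1) + ρ)) *⁰ trace))

    next-ρ′ : A + ι (+ 2) + A * ρ′ - ρ′ ² ≈ ρ″
    next-ρ′ = -≈0⇒≈ (trans
      (solve 4 (λ A ρ ρ′ ρ″ →
        A :+ con (+ 2) :+ A :* ρ′ :- ρ′ :* ρ′ :- ρ″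
          := (ρ :* ρ′ :+ ρ :+ con (+ 1)) :+ (ρ′ :* ρ″ :+ ρ′ :+ con (+ 1))
            :+ (:- (con (+ 1) :+ ρ′)) :* (ρ :+ ρ′ :+ ρ″ :- A))
        refl A ρ ρ′ ρ″)
      (ρρ′+ρ+1 +⁰ ρ′ρ″+ρ′+1 +⁰ (- (ι (+ 1) + ρ′)) *⁰ trace))

    next-ρ″ : A + ι (+ 2) + A * ρ″ - ρ″ ² ≈ ρ
    next-ρ″ = -≈0⇒≈ (trans
      (solve 4 (λ A ρ ρ′ ρ″ →
        A :+ con (+ 2) :+ A :* ρ″ :- ρ″ :* ρ″ :- ρ
          := (ρ :* ρ″ :+ ρ″ :+ con (+ 1)) :+ (ρ′ :* ρ″ :+ ρ′ :+ con (+ 1))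
            :+ (:- (con (+ 1) :+ ρ″)) :* (ρ :+ ρ′ :+ ρ″ :- A))
        refl A ρ ρ′ ρ″)
      (ρρ″+ρ″+1 +⁰ ρ′ρ″+ρ′+1 +⁰ (- (ι (+ 1) + ρ″)) *⁰ trace))

    ρ-expansion : ρ ≈ A + ι (+ 1) + (- ι (+ 1) - ρ′) + - ρ″
    ρ-expansion = -≈0⇒≈ (trans
      (solve 4 (λ A ρ ρ′ ρ″ →
        ρ :- (A :+ con (+ 1) :+ (:- con (+ 1) :- ρ′) :+ :- ρ″) := ρ :+ ρ′ :+ ρ″ :- A)
        refl A ρ ρ′ ρ″)
      trace)

    ρs≈1 : ρ * (- ι (+ 1) - ρ′) ≈ ι (+ 1)
    ρs≈1 = -≈0⇒≈ (trans
      (solve 2 (λ ρ ρ′ →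
        ρ :* (:- con (+ 1) :- ρ′) :- con (+ 1) := :- (ρ :* ρ′ :+ ρ :+ con (+ 1))) refl ρ ρ′)
      (-⁰ ρρ′+ρ+1))

    [ρ+1]t≈1 : (ρ + ι (+ 1)) * - ρ″ ≈ ι (+ 1)
    [ρ+1]t≈1 = -≈0⇒≈ (trans
      (solve 2 (λ ρ ρ″ →
        (ρ :+ con (+ 1)) :* (:- ρ″) :- con (+ 1) := :- (ρ :* ρ″ :+ ρ″ :+ con (+ 1))) refl ρ ρ″)
      (-⁰ ρρ″+ρ″+1))

  -- Bounds on the conjugates, and the coordinates that they leave.

  -- Here s = −1 − ρ′ and t = −ρ″, both about 1/A, and r = ρ.
  module Bounds {A s t : Carrier} (m>0 : Pos (A - ι (+ 14))) (s>0 : Pos s) (t>0 : Pos t)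
    (rs : (A + ι (+ 1) + s + t) * s ≈ ι (+ 1)) (rt : (A + ι (+ 1) + s + t + ι (+ 1)) * t ≈ ι (+ 1))
    where

    r : Carrier
    r = A + ι (+ 1) + s + t

    private
      m = A - ι (+ 14)
      p = ι (+ 1) - s

      S⁰ : r * s - ι (+ 1) ≈ ι (+ 0)
      S⁰ = ≈⇒-≈0 rs

      U⁰ : (r + ι (+ 1)) * t - ι (+ 1) ≈ ι (+ 0)
      U⁰ = ≈⇒-≈0 rt

      A>0 : Pos A
      A>0 = pos-resp (solve 1 (λ A → A :- con (+ 14) :+ con (+ 14) := A) refl A) (m>0 +⁺ pos-ι 13)

      r>0 : Pos r
      r>0 = A>0 +⁺ pos-ι 0 +⁺ s>0 +⁺ t>0

      -- Because rs = 1, the difference is s(r - 4). The factor 4 is the one that the bound on `γ′`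
      -- asks for.
      1-4s>0 : Pos (ι (+ 1) - ι (+ 4) * s)
      1-4s>0 = pos-mod
        (solve 3 (λ A s t → let r = A :+ con (+ 1) :+ s :+ t in
          con (+ 1) :- con (+ 4) :* s
            := s :* (A :- con (+ 14) :+ con (+ 11) :+ s :+ t) :+ :- (r :* s :- con (+ 1)))
          refl A s t)
        (s>0 *⁺ (m>0 +⁺ pos-ι 10 +⁺ s>0 +⁺ t>0)) (-⁰ S⁰)

      p>0 : Pos p
      p>0 = pos-resp
        (solve 1 (λ s → con (+ 1) :- con (+ 4) :* s :+ con (+ 3) :* s := con (+ 1) :- s) refl s)
        (1-4s>0 +⁺ pos-ι 2 *⁺ s>0)

      1-t>0 : Pos (ι (+ 1) - t)
      1-t>0 = pos-mod
        (solve 3 (λ A s t → let r = A :+ con (+ 1) :+ s :+ t in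
          con (+ 1) :- t := r :* t :+ :- ((r :+ con (+ 1)) :* t :- con (+ 1)))
          refl A s t)
        (r>0 *⁺ t>0) (-⁰ U⁰)

      -- From s = 1/r and t = 1/(r + 1) follows 1/t - 1/s = 1; this is that equation without
      -- denominators.
      V⁰ : s - t - s * t ≈ ι (+ 0)
      V⁰ = trans
        (solve 3 (λ A s t → let r = A :+ con (+ 1) :+ s :+ t in
          s :- t :- s :* t
            := t :* (r :* s :- con (+ 1)) :+ (:- s) :* ((r :+ con (+ 1)) :* t :- con (+ 1)))
          refl A s t)
        (t *⁰ S⁰ +⁰ (- s) *⁰ U⁰)

      s-t>0 : Pos (s - t)
      s-t>0 = pos-mod
        (solve 2 (λ s t → s :- t := s :* t :+ (s :- t :- s :* t)) refl s t) (s>0 *⁺ t>0) V⁰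

      w>0 : Pos (ι (+ 1) - t + s)
      w>0 = 1-t>0 +⁺ s>0

    -- The last three are the values of γ at the roots, written with its coefficients a + 12, a + 1,
    -- a - 2 and with ρ = r, ρ′ = -(1 + s), ρ″ = -t.
    B B′ B″ γ γ′ γ″ : Carrier
    B  = A + ι (+ 2)
    B′ = ι (+ 3) + t
    B″ = A + ι (+ 1)
    γ  = A + ι (+ 12) + (A + ι (+ 1)) * r - (A - ι (+ 2)) * (ι (+ 1) + s)
    γ′ = A + ι (+ 12) - (A + ι (+ 1)) * (ι (+ 1) + s) - (A - ι (+ 2)) * t
    γ″ = A + ι (+ 12) - (A + ι (+ 1)) * t + (A - ι (+ 2)) * r

    B>0 : Pos B
    B>0 = A>0 +⁺ pos-ι 1

    B′>0 : Pos B′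
    B′>0 = pos-ι 2 +⁺ t>0

    B″>0 : Pos B″
    B″>0 = A>0 +⁺ pos-ι 0

    γ<B² : Pos (B ² - γ)
    γ<B² = pos-mod
      (solve 3 (λ A s t → let r = A :+ con (+ 1) :+ s :+ t; B = A :+ con (+ 2) in
        B :* B :- (A :+ con (+ 12) :+ (A :+ con (+ 1)) :* r :- (A :- con (+ 2)) :* (con (+ 1) :+ s))
          := con (+ 2) :* (A :- con (+ 14)) :+ con (+ 13) :+ con (+ 3) :* (con (+ 1) :- s)
               :+ t :+ t :* (s :+ t)
            :+ :- ((r :+ con (+ 1)) :* t :- con (+ 1)))
        refl A s t)
      (pos-ι 1 *⁺ m>0 +⁺ pos-ι 12 +⁺ pos-ι 2 *⁺ p>0 +⁺ t>0 +⁺ t>0 *⁺ (s>0 +⁺ t>0))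
      (-⁰ U⁰)

    -- The tight case. Modulo the relations `γ′` is 9 + 4t + (s + t)², so the slack is only t(2 - 3s
    -- - s²). It is of the order of t itself, and a common factor t has to be split off before its
    -- sign is clear; replacing s² by st + s²t, which is s times s - t = st, achieves this.
    γ′<B′² : Pos (B′ ² - γ′)
    γ′<B′² = pos-mod
      (solve 3 (λ A s t → let r = A :+ con (+ 1) :+ s :+ t; B = con (+ 3) :+ t in
        B :* B :- (A :+ con (+ 12) :- (A :+ con (+ 1)) :* (con (+ 1) :+ s) :- (A :- con (+ 2)) :* t)
          := t :* (con (+ 1) :- con (+ 4) :* s :+ con (+ 1) :+ s :* (con (+ 1) :- s))
            :+ ((r :* s :- con (+ 1)) :+ ((r :+ con (+ 1)) :* t :- con (+ 1))
                 :+ (:- s) :* (s :- t :- s :* t)))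
        refl A s t)
      (t>0 *⁺ (1-4s>0 +⁺ pos-ι 0 +⁺ s>0 *⁺ p>0))
      (S⁰ +⁰ U⁰ +⁰ (- s) *⁰ V⁰)

    γ″<B″² : Pos (B″ ² - γ″)
    γ″<B″² = pos-mod
      (solve 3 (λ A s t → let r = A :+ con (+ 1) :+ s :+ t; B = A :+ con (+ 1) in
        B :* B :- (A :+ con (+ 12) :- (A :+ con (+ 1)) :* t :+ (A :- con (+ 2)) :* r)
          := con (+ 2) :* (A :- con (+ 14)) :+ con (+ 18) :+ con (+ 3) :* t :+ con (+ 3) :* s
               :+ s :* s :+ s :* t
            :+ :- (r :* s :- con (+ 1)))
        refl A s t)
      (pos-ι 1 *⁺ m>0 +⁺ pos-ι 17 +⁺ pos-ι 2 *⁺ t>0 +⁺ pos-ι 2 *⁺ s>0 +⁺ s>0 *⁺ s>0 +⁺ s>0 *⁺ t>0)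
      (-⁰ S⁰)

    -- The values of x + yρ + zρ′ at the three roots: the pair (ρ, ρ′) becomes (ρ′, ρ″) and then
    -- (ρ″, ρ).
    b b′ b″ : ℤ → ℤ → ℤ → Carrier
    b  x y z = ι x + ι y * r - ι z * (ι (+ 1) + s)
    b′ x y z = ι x - ι y * (ι (+ 1) + s) - ι z * t
    b″ x y z = ι x - ι y * t + ι z * r

    record Small (x y z : ℤ) : Set where
      constructor small
      field
        b<B    : Pos (B - b x y z)
        -B<b   : Pos (B + b x y z)
        b′<B′  : Pos (B′ - b′ x y z)
        -B′<b′ : Pos (B′ + b′ x y z)
        b″<B″  : Pos (B″ - b″ x y z)
        -B″<b″ : Pos (B″ + b″ x y z)

    -- Cramer's rule expresses y and z through b − b′ and b″ − b′; the determinant is positive.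
    candidate-range : ∀ {x y z} → Small x y z → y ℤ.< + 2 × z ℤ.< + 2
    candidate-range {x} {y} {z} (small b<B -B<b b′<B′ -B′<b′ b″<B″ -B″<b″) =
        -- The determinant times y is (r + t)(b - b′) + w(b″ - b′). The two last summands of the
        -- identity are the slack in bounding these differences; the others certify that twice the
        -- determinant exceeds (r + t)(B + B′) + w(B″ + B′).
        ι-reflects-< (pos-cancel det>0 (pos-resp
          (solve 6 (λ A s t X Y Z →
            let r = A :+ con (+ 1) :+ s :+ t; w = con (+ 1) :- t :+ s
                m = A :- con (+ 14); p = con (+ 1) :- s
                b  = X :+ Y :* r :- Z :* (con (+ 1) :+ s)
                b′ = X :- Y :* (con (+ 1) :+ s) :- Z :* t
                b″ = X :- Y :* t :+ Z :* r
            in (m :+ con (+ 9) :+ s :+ con (+ 2) :* t) :* (m :+ con (+ 13) :+ con (+ 4) :* s :+ t)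
                 :+ (p :+ t) :* (A :+ con (+ 3) :* t :+ con (+ 2) :* p)
                 :+ con (+ 46) :+ con (+ 4) :* m :+ con (+ 28) :* s
                 :+ (r :+ t) :* (A :+ con (+ 2) :- b :+ (con (+ 3) :+ t :+ b′))
                 :+ w :* (A :+ con (+ 1) :- b″ :+ (con (+ 3) :+ t :+ b′))
               := ((r :+ con (+ 1) :+ s) :* (r :+ t) :+ w :* w) :* (con (+ 2) :- Y))
            refl A s t (ι x) (ι y) (ι z))
          ((m>0 +⁺ pos-ι 8 +⁺ s>0 +⁺ pos-ι 1 *⁺ t>0) *⁺ (m>0 +⁺ pos-ι 12 +⁺ pos-ι 3 *⁺ s>0 +⁺ t>0)
             +⁺ (p>0 +⁺ t>0) *⁺ (A>0 +⁺ pos-ι 2 *⁺ t>0 +⁺ pos-ι 1 *⁺ p>0)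
             +⁺ pos-ι 45 +⁺ pos-ι 3 *⁺ m>0 +⁺ pos-ι 27 *⁺ s>0
             +⁺ (r>0 +⁺ t>0) *⁺ (b<B +⁺ -B′<b′)
             +⁺ w>0 *⁺ (b″<B″ +⁺ -B′<b′))))
      -- For z the difference b - b′ carries the coefficient -w, so here it must be bounded from
      -- below.
      , ι-reflects-< (pos-cancel det>0 (pos-resp
          (solve 6 (λ A s t X Y Z →
            let r = A :+ con (+ 1) :+ s :+ t; w = con (+ 1) :- t :+ s
                m = A :- con (+ 14); p = con (+ 1) :- s
                b  = X :+ Y :* r :- Z :* (con (+ 1) :+ s)
                b′ = X :- Y :* (con (+ 1) :+ s) :- Z :* t
                b″ = X :- Y :* t :+ Z :* r
            in (m :+ con (+ 10) :+ con (+ 2) :* s :+ t)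
                   :* (m :+ con (+ 12) :+ con (+ 2) :* s :+ con (+ 3) :* t)
                 :+ (p :+ t) :* (A :+ con (+ 1) :+ con (+ 3) :* t :+ con (+ 2) :* p)
                 :+ con (+ 38) :+ con (+ 4) :* m :+ con (+ 16) :* s :+ con (+ 12) :* t
                 :+ (r :+ con (+ 1) :+ s) :* (A :+ con (+ 1) :- b″ :+ (con (+ 3) :+ t :+ b′))
                 :+ w :* (A :+ con (+ 2) :+ b :+ (con (+ 3) :+ t :- b′))
               := ((r :+ con (+ 1) :+ s) :* (r :+ t) :+ w :* w) :* (con (+ 2) :- Z))
            refl A s t (ι x) (ι y) (ι z))
          ((m>0 +⁺ pos-ι 9 +⁺ pos-ι 1 *⁺ s>0 +⁺ t>0)
               *⁺ (m>0 +⁺ pos-ι 11 +⁺ pos-ι 1 *⁺ s>0 +⁺ pos-ι 2 *⁺ t>0)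
             +⁺ (p>0 +⁺ t>0) *⁺ (A>0 +⁺ pos-ι 0 +⁺ pos-ι 2 *⁺ t>0 +⁺ pos-ι 1 *⁺ p>0)
             +⁺ pos-ι 37 +⁺ pos-ι 3 *⁺ m>0 +⁺ pos-ι 15 *⁺ s>0 +⁺ pos-ι 11 *⁺ t>0
             +⁺ (r>0 +⁺ pos-ι 0 +⁺ s>0) *⁺ (b″<B″ +⁺ -B′<b′)
             +⁺ w>0 *⁺ (-B<b +⁺ b′<B′))))
      where
      det>0 : Pos ((r + ι (+ 1) + s) * (r + t) + (ι (+ 1) - t + s) * (ι (+ 1) - t + s))
      det>0 = (r>0 +⁺ pos-ι 0 +⁺ s>0) *⁺ (r>0 +⁺ t>0) +⁺ w>0 *⁺ w>0

    small-neg : ∀ {x y z} → Small x y z → Small (ℤ.- x) (ℤ.- y) (ℤ.- z)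
    small-neg {x} {y} {z} (small b<B -B<b b′<B′ -B′<b′ b″<B″ -B″<b″) = small
      (flip⁻ neg-b -B<b) (flip⁺ neg-b b<B)
      (flip⁻ neg-b′ -B′<b′) (flip⁺ neg-b′ b′<B′)
      (flip⁻ neg-b″ -B″<b″) (flip⁺ neg-b″ b″<B″)
      where
      flip⁻ : ∀ {c d C} → d ≈ - c → Pos (C + c) → Pos (C - d)
      flip⁻ {c} {d} {C} d≈-c = pos-resp (+-congˡ (sym (trans (-‿cong d≈-c)
        (solve 1 (λ c → :- (:- c) := c) refl c))))
      flip⁺ : ∀ {c d C} → d ≈ - c → Pos (C - c) → Pos (C + d)
      flip⁺ d≈-c = pos-resp (+-congˡ (sym d≈-c))
      neg-b : b (ℤ.- x) (ℤ.- y) (ℤ.- z) ≈ - b x y z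
      neg-b = trans
        (+-cong (+-cong (ι-neg x) (*-congʳ (ι-neg y))) (-‿cong (*-congʳ (ι-neg z))))
        (solve 5 (λ X Y Z r s →
          (:- X) :+ (:- Y) :* r :- (:- Z) :* (con (+ 1) :+ s)
            := :- (X :+ Y :* r :- Z :* (con (+ 1) :+ s))) refl (ι x) (ι y) (ι z) r s)
      neg-b′ : b′ (ℤ.- x) (ℤ.- y) (ℤ.- z) ≈ - b′ x y z
      neg-b′ = trans
        (+-cong (+-cong (ι-neg x) (-‿cong (*-congʳ (ι-neg y)))) (-‿cong (*-congʳ (ι-neg z))))
        (solve 5 (λ X Y Z s t →
          (:- X) :- (:- Y) :* (con (+ 1) :+ s) :- (:- Z) :* t
            := :- (X :- Y :* (con (+ 1) :+ s) :- Z :* t)) refl (ι x) (ι y) (ι z) s t)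
      neg-b″ : b″ (ℤ.- x) (ℤ.- y) (ℤ.- z) ≈ - b″ x y z
      neg-b″ = trans
        (+-cong (+-cong (ι-neg x) (-‿cong (*-congʳ (ι-neg y)))) (*-congʳ (ι-neg z)))
        (solve 5 (λ X Y Z r t →
          (:- X) :- (:- Y) :* t :+ (:- Z) :* r
            := :- (X :- Y :* t :+ Z :* r)) refl (ι x) (ι y) (ι z) r t)

    private
      candidate[0,0] : ∀ {x} → Small x (+ 0) (+ 0) → Candidate x (+ 0) (+ 0)
      candidate[0,0] {x} sm = rational
        (ι-reflects-< (pos-resp
          (solve 3 (λ s t x →
            con (+ 3) :+ t :- (x :- con (+ 0) :* (con (+ 1) :+ s) :- con (+ 0) :* t)
                :+ (con (+ 1) :- t)
              := con (+ 4) :- x) refl s t (ι x))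
          (Small.b′<B′ sm +⁺ 1-t>0)))
        (ι-reflects-< (pos-resp
          (solve 3 (λ s t x →
            con (+ 3) :+ t :+ (x :- con (+ 0) :* (con (+ 1) :+ s) :- con (+ 0) :* t)
                :+ (con (+ 1) :- t)
              := x :- con -[1+ 3 ]) refl s t (ι x))
          (Small.-B′<b′ sm +⁺ 1-t>0)))

      candidate[1,0] : ∀ {x} → Small x (+ 1) (+ 0) → Candidate x (+ 1) (+ 0)
      candidate[1,0] {x} sm = pick x
        (ι-reflects-< (pos-resp
          (solve 4 (λ A s t x → let r = A :+ con (+ 1) :+ s :+ t in
            A :+ con (+ 2) :- (x :+ con (+ 1) :* r :- con (+ 0) :* (con (+ 1) :+ s)) :+ s :+ t
              := con (+ 1) :- x) refl A s t (ι x))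
          (Small.b<B sm +⁺ s>0 +⁺ t>0)))
        -- At x = -2 the value at ρ′ would be -(3 + s), which lies below -(3 + t) because s exceeds
        -- t.
        (ι-reflects-< (pos-resp
          (solve 3 (λ s t x →
            con (+ 3) :+ t :+ (x :- con (+ 1) :* (con (+ 1) :+ s) :- con (+ 0) :* t) :+ (s :- t)
              := x :- con -[1+ 1 ]) refl s t (ι x))
          (Small.-B′<b′ sm +⁺ s-t>0)))
        where
        pick : ∀ x → x ℤ.< + 1 → -[1+ 1 ] ℤ.< x → Candidate x (+ 1) (+ 0)
        pick (+ zero)         _                      _                          = [ρ]
        pick (+ suc _)        (ℤ.+<+ (ℕ.s≤s ()))     _
        pick -[1+ zero ]      _                      _                          = [ρ-1]
        pick -[1+ suc n ]     _                      (ℤ.-<- (ℕ.s≤s ()))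

      candidate[0,1] : ∀ {x} → Small x (+ 0) (+ 1) → Candidate x (+ 0) (+ 1)
      candidate[0,1] {x} sm = pick x
        (ι-reflects-< (pos-resp
          (solve 4 (λ A s t x → let r = A :+ con (+ 1) :+ s :+ t in
            A :+ con (+ 1) :- (x :- con (+ 0) :* t :+ con (+ 1) :* r) :+ s :+ t
              := con (+ 0) :- x) refl A s t (ι x))
          (Small.b″<B″ sm +⁺ s>0 +⁺ t>0)))
        -- At x = -3 the value at ρ′ is exactly -B′, so the strict bound excludes it with nothing to
        -- spare.
        (ι-reflects-< (pos-resp
          (solve 3 (λ s t x →
            con (+ 3) :+ t :+ (x :- con (+ 0) :* (con (+ 1) :+ s) :- con (+ 1) :* t)
              := x :- con -[1+ 2 ]) refl s t (ι x))
          (Small.-B′<b′ sm)))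
        where
        pick : ∀ x → x ℤ.< + 0 → -[1+ 2 ] ℤ.< x → Candidate x (+ 0) (+ 1)
        pick (+ _)                (ℤ.+<+ ())  _
        pick -[1+ zero ]          _           _                                  = [ρ′-1]
        pick -[1+ suc zero ]      _           _                                  = [ρ′-2]
        pick -[1+ suc (suc n) ]   _           (ℤ.-<- (ℕ.s≤s (ℕ.s≤s ())))

      candidate[1,1] : ∀ {x} → Small x (+ 1) (+ 1) → Candidate x (+ 1) (+ 1)
      candidate[1,1] {x} sm = pick x
        (ι-reflects-< (pos-resp
          (solve 4 (λ A s t x → let r = A :+ con (+ 1) :+ s :+ t in
            A :+ con (+ 1) :- (x :- con (+ 1) :* t :+ con (+ 1) :* r) :+ s
              := con (+ 0) :- x) refl A s t (ι x))
          (Small.b″<B″ sm +⁺ s>0)))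
        (ι-reflects-< (pos-resp
          (solve 3 (λ s t x →
            con (+ 3) :+ t :+ (x :- con (+ 1) :* (con (+ 1) :+ s) :- con (+ 1) :* t) :+ s
              := x :- con -[1+ 1 ]) refl s t (ι x))
          (Small.-B′<b′ sm +⁺ s>0)))
        where
        pick : ∀ x → x ℤ.< + 0 → -[1+ 1 ] ℤ.< x → Candidate x (+ 1) (+ 1)
        pick (+ _)           (ℤ.+<+ ())  _
        pick -[1+ zero ]     _           _                    = [ρ+ρ′-1]
        pick -[1+ suc n ]    _           (ℤ.-<- (ℕ.s≤s ()))

      -- The difference ρ - ρ′ exceeds A + 2 at ρ, and its conjugate at ρ″ is below -(A + 1). The
      -- first forces x to be negative, the second to be positive.
      ¬small[1,-1] : ∀ {x} → ¬ Small x (+ 1) -[1+ 0 ]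
      ¬small[1,-1] {x} sm = ℤₚ.<-asym
        (ι-reflects-< {x} {+ 0} (pos-resp
          (solve 4 (λ A s t x → let r = A :+ con (+ 1) :+ s :+ t in
            A :+ con (+ 2) :- (x :+ con (+ 1) :* r :- con -[1+ 0 ] :* (con (+ 1) :+ s))
                :+ con (+ 2) :* s :+ t
              := con (+ 0) :- x) refl A s t (ι x))
          (Small.b<B sm +⁺ pos-ι 1 *⁺ s>0 +⁺ t>0)))
        (ι-reflects-< {+ 0} {x} (pos-resp
          (solve 4 (λ A s t x → let r = A :+ con (+ 1) :+ s :+ t in
            A :+ con (+ 1) :+ (x :- con (+ 1) :* t :+ con -[1+ 0 ] :* r)
                :+ s :+ con (+ 2) :* t
              := x :- con (+ 0)) refl A s t (ι x))
          (Small.-B″<b″ sm +⁺ s>0 +⁺ pos-ι 1 *⁺ t>0)))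

      data Unital : ℤ → Set where
        -1ᵘ : Unital -[1+ 0 ]
        0ᵘ  : Unital (+ 0)
        1ᵘ  : Unital (+ 1)

      unital : ∀ k → k ℤ.< + 2 → ℤ.- k ℤ.< + 2 → Unital k
      unital (+ 0)             _                             _ = 0ᵘ
      unital (+ 1)             _                             _ = 1ᵘ
      unital (+ suc (suc _))   (ℤ.+<+ (ℕ.s≤s (ℕ.s≤s ())))    _
      unital -[1+ zero ]       _                             _ = -1ᵘ
      unital -[1+ suc _ ]      _                             (ℤ.+<+ (ℕ.s≤s (ℕ.s≤s ())))

      sort : ∀ {x y z} → Unital y → Unital z → Small x y z →
             Candidate x y z ⊎ Candidate (ℤ.- x) (ℤ.- y) (ℤ.- z)
      sort 0ᵘ  0ᵘ  sm = inj₁ (candidate[0,0] sm)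
      sort 1ᵘ  0ᵘ  sm = inj₁ (candidate[1,0] sm)
      sort 0ᵘ  1ᵘ  sm = inj₁ (candidate[0,1] sm)
      sort 1ᵘ  1ᵘ  sm = inj₁ (candidate[1,1] sm)
      sort 1ᵘ  -1ᵘ sm = ⊥-elim (¬small[1,-1] sm)
      sort -1ᵘ 0ᵘ  sm = inj₂ (candidate[1,0] (small-neg sm))
      sort 0ᵘ  -1ᵘ sm = inj₂ (candidate[0,1] (small-neg sm))
      sort -1ᵘ -1ᵘ sm = inj₂ (candidate[1,1] (small-neg sm))
      sort -1ᵘ 1ᵘ  sm = ⊥-elim (¬small[1,-1] (small-neg sm))

    classify : ∀ {x y z} → Small x y z → Candidate x y z ⊎ Candidate (ℤ.- x) (ℤ.- y) (ℤ.- z)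
    classify {x} {y} {z} sm =
      let y<2 , z<2 = candidate-range sm
          -y<2 , -z<2 = candidate-range (small-neg sm)
      in sort (unital y y<2 -y<2) (unital z z<2 -z<2) sm

  -- Evaluating coordinate triples at the roots.

  module Evaluation (a : ℤ) where
    open Coordinates a

    infixl 6 _⊞_
    infixl 7 _⊠_

    _⊞_ : ∀ {m n x y} → ι m ≈ x → ι n ≈ y → ι (m ℤ.+ n) ≈ x + y
    _⊞_ {m} {n} p q = trans (ι-+ m n) (+-cong p q)

    _⊠_ : ∀ {m n x y} → ι m ≈ x → ι n ≈ y → ι (m ℤ.* n) ≈ x * y
    _⊠_ {m} {n} p q = trans (ι-* m n) (*-cong p q)

    A : Carrier
    A = ι a

    evalAt : Carrier → ℤ[ρ] → Carrier
    evalAt x ⟨ p , q , r ⟩ = ι p + ι q * x + ι r * x ²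

    -- `times` is multiplication of polynomials modulo the cubic, so the two sides differ by a
    -- multiple of the cubic at x; the cofactor in the identity is the negated quotient.
    evalAt-square : ∀ {x} → cubic A x ≈ ι (+ 0) →
                    ∀ α → evalAt x (times α α) ≈ evalAt x α ²
    evalAt-square {x} root ⟨ p , q , r ⟩ = trans
      (+-cong (+-cong ι-times₀ (*-congʳ ι-times₁)) (*-congʳ ι-times₂))
      (-≈0⇒≈ (trans
        (solve 5 (λ A x P Q R →
          let u = Q :+ A :* R; v = P :+ (A :+ con (+ 3)) :* R in
          P :* P :+ Q :* R :+ R :* u
            :+ (P :* Q :+ Q :* v :+ R :* (R :+ (A :+ con (+ 3)) :* u)) :* x
            :+ (P :* R :+ Q :* u :+ R :* (v :+ A :* u)) :* (x :* x)
            :- (P :+ Q :* x :+ R :* (x :* x)) :* (P :+ Q :* x :+ R :* (x :* x))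
          := (:- (Q :* R :+ R :* (x :* R :+ u)))
               :* (x :* x :* x :- A :* (x :* x) :- (A :+ con (+ 3)) :* x :- con (+ 1)))
          refl A x (ι p) (ι q) (ι r))
        (_ *⁰ root)))
      where
      ι-u : ι (q ℤ.+ a ℤ.* r) ≈ ι q + A * ι r
      ι-u = refl ⊞ refl ⊠ refl
      ι-v : ι (p ℤ.+ (a ℤ.+ + 3) ℤ.* r) ≈ ι p + (A + ι (+ 3)) * ι r
      ι-v = refl ⊞ (refl ⊞ refl) ⊠ refl
      ι-times₀ : ι (p ℤ.* p ℤ.+ q ℤ.* r ℤ.+ r ℤ.* (q ℤ.+ a ℤ.* r))
                 ≈ ι p * ι p + ι q * ι r + ι r * (ι q + A * ι r)
      ι-times₀ = refl ⊠ refl ⊞ refl ⊠ refl ⊞ refl ⊠ ι-u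
      ι-times₁ : ι (p ℤ.* q ℤ.+ q ℤ.* (p ℤ.+ (a ℤ.+ + 3) ℤ.* r)
                     ℤ.+ r ℤ.* (r ℤ.+ (a ℤ.+ + 3) ℤ.* (q ℤ.+ a ℤ.* r)))
                 ≈ ι p * ι q + ι q * (ι p + (A + ι (+ 3)) * ι r)
                     + ι r * (ι r + (A + ι (+ 3)) * (ι q + A * ι r))
      ι-times₁ = refl ⊠ refl ⊞ refl ⊠ ι-v ⊞ refl ⊠ (refl ⊞ (refl ⊞ refl) ⊠ ι-u)
      ι-times₂ : ι (p ℤ.* r ℤ.+ q ℤ.* (q ℤ.+ a ℤ.* r)
                     ℤ.+ r ℤ.* (p ℤ.+ (a ℤ.+ + 3) ℤ.* r ℤ.+ a ℤ.* (q ℤ.+ a ℤ.* r)))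
                 ≈ ι p * ι r + ι q * (ι q + A * ι r)
                     + ι r * (ι p + (A + ι (+ 3)) * ι r + A * (ι q + A * ι r))
      ι-times₂ = refl ⊠ refl ⊞ refl ⊠ ι-u ⊞ refl ⊠ (ι-v ⊞ refl ⊠ ι-u)

    evalAt-embed : ∀ {x x⁺} → A + ι (+ 2) + A * x - x ² ≈ x⁺ →
                   ∀ k l m → evalAt x (embed k l m) ≈ ι k + ι l * x + ι m * x⁺
    evalAt-embed {x} next k l m = trans
      (+-cong (+-cong (refl ⊞ (refl ⊞ refl) ⊠ refl) (*-congʳ (refl ⊞ refl ⊠ refl)))
        (*-congʳ (ι-neg m)))
      (trans
        (solve 5 (λ A x K L M →
          K :+ (A :+ con (+ 2)) :* M :+ (L :+ A :* M) :* x :+ (:- M) :* (x :* x)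
            := K :+ L :* x :+ M :* (A :+ con (+ 2) :+ A :* x :- x :* x))
          refl A x (ι k) (ι l) (ι m))
        (+-congˡ (*-congˡ next)))

    evalAt-rational : ∀ x k → evalAt x ⟨ k , + 0 , + 0 ⟩ ≈ ι k
    evalAt-rational x k =
      solve 2 (λ x K → K :+ con (+ 0) :* x :+ con (+ 0) :* (x :* x) := K) refl x (ι k)

    -- The left side is (uvw)²(u - k)². This single computation explains all four products of
    -- conjugates, with k = 1, 1, 2 and a - 1.
    square-product : ∀ {u v w} k → u * v * w ≈ ι (+ 1) →
                     v ² * w ² * (- (k * u) + u ²) ² ≈ (u - k) ²
    square-product {u} {v} {w} k uvw≈1 = -≈0⇒≈ (trans
      (solve 4 (λ u v w k →
        v :* v :* (w :* w) :* ((:- (k :* u) :+ u :* u) :* (:- (k :* u) :+ u :* u))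
            :- (u :- k) :* (u :- k)
          := (u :* v :* w :+ con (+ 1)) :* (u :- k) :* (u :- k) :* (u :* v :* w :- con (+ 1)))
        refl u v w k)
      (_ *⁰ ≈⇒-≈0 uvw≈1))

    IsRoot : Carrier → Set
    IsRoot x = x * x * x - A * x ² - ι (a ℤ.+ + 3) * x - ι (+ 1) ≈ ι (+ 0)

    IsRoot⇒cubic : ∀ {x} → IsRoot x → cubic A x ≈ ι (+ 0)
    IsRoot⇒cubic = trans (+-congʳ (+-congˡ (-‿cong (*-congʳ (sym (ι-+ a (+ 3)))))))

    module Conjugates {ρ ρ′ ρ″ : Carrier} (15≤a : + 15 ℤ.≤ a)
      (root : IsRoot ρ) (root′ : IsRoot ρ′) (root″ : IsRoot ρ″)
      (ρ>a+1 : Pos (ρ - ι (a ℤ.+ + 1))) (ρ′<-1 : Pos (ι (ℤ.- (+ 1)) - ρ′))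
      (ρ″>-1 : Pos (ρ″ - ι (ℤ.- (+ 1)))) (ρ″<0 : Pos (ι (+ 0) - ρ″))
      where

      private
        cubic₀ : cubic A ρ ≈ ι (+ 0)
        cubic₀ = IsRoot⇒cubic root

        cubic′ : cubic A ρ′ ≈ ι (+ 0)
        cubic′ = IsRoot⇒cubic root′

        cubic″ : cubic A ρ″ ≈ ι (+ 0)
        cubic″ = IsRoot⇒cubic root″

        A-14>0 : Pos (A - ι (+ 14))
        A-14>0 = ι-mono-< (ℤₚ.<-≤-trans (ℤ.+<+ ℕₚ.≤-refl) 15≤a)

        A>0 : Pos A
        A>0 = pos-resp (solve 1 (λ A → A :- con (+ 0) := A) refl A)
          (ι-mono-< (ℤₚ.<-≤-trans (ℤ.+<+ (ℕ.s≤s ℕ.z≤n)) 15≤a))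

        s t : Carrier
        s = - ι (+ 1) - ρ′
        t = - ρ″

        s>0 : Pos s
        s>0 = pos-resp (+-congʳ (ι-neg (+ 1))) ρ′<-1

        t>0 : Pos t
        t>0 = pos-resp (solve 1 (λ x → con (+ 0) :- x := :- x) refl ρ″) ρ″<0

        ρ>A+1 : Pos (ρ - (A + ι (+ 1)))
        ρ>A+1 = pos-resp (+-congˡ (-‿cong (ι-+ a (+ 1)))) ρ>a+1

        ρ″+1>0 : Pos (ρ″ + ι (+ 1))
        ρ″+1>0 = pos-resp (solve 1 (λ x → x :- con -[1+ 0 ] := x :+ con (+ 1)) refl ρ″) ρ″>-1

        open Relations cubic₀ cubic′ cubic″ A>0 ρ>A+1 s>0 ρ″+1>0 t>0

        rs : (A + ι (+ 1) + s + t) * s ≈ ι (+ 1)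
        rs = trans (*-congʳ (sym ρ-expansion)) ρs≈1

        rt : (A + ι (+ 1) + s + t + ι (+ 1)) * t ≈ ι (+ 1)
        rt = trans (*-congʳ (+-congʳ (sym ρ-expansion))) [ρ+1]t≈1

        open Bounds A-14>0 s>0 t>0 rs rt

        evalAt-b : ∀ x y z → evalAt ρ (embed x y z) ≈ b x y z
        evalAt-b x y z = trans (evalAt-embed next-ρ x y z) (trans
          (+-congʳ (+-congˡ (*-congˡ ρ-expansion)))
          (solve 5 (λ X Y Z r ρ′ →
            X :+ Y :* r :+ Z :* ρ′ := X :+ Y :* r :- Z :* (con (+ 1) :+ (:- con (+ 1) :- ρ′)))
            refl (ι x) (ι y) (ι z) r ρ′))

        evalAt-b′ : ∀ x y z → evalAt ρ′ (embed x y z) ≈ b′ x y z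
        evalAt-b′ x y z = trans (evalAt-embed next-ρ′ x y z)
          (solve 5 (λ X Y Z ρ′ ρ″ →
            X :+ Y :* ρ′ :+ Z :* ρ″
              := X :- Y :* (con (+ 1) :+ (:- con (+ 1) :- ρ′)) :- Z :* (:- ρ″))
            refl (ι x) (ι y) (ι z) ρ′ ρ″)

        evalAt-b″ : ∀ x y z → evalAt ρ″ (embed x y z) ≈ b″ x y z
        evalAt-b″ x y z = trans (evalAt-embed next-ρ″ x y z) (trans
          (+-congˡ (*-congˡ ρ-expansion))
          (solve 5 (λ X Y Z r ρ″ →
            X :+ Y :* ρ″ :+ Z :* r := X :- Y :* (:- ρ″) :+ Z :* r)
            refl (ι x) (ι y) (ι z) r ρ″))

        ι-a-2 : ι (a ℤ.- + 2) ≈ A - ι (+ 2)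
        ι-a-2 = trans (ι-+ a (ℤ.- (+ 2))) (+-congˡ (ι-neg (+ 2)))

      γ̂ : ℤ[ρ]
      γ̂ = ⟨ a ℤ.* a ℤ.+ a ℤ.+ + 8 , a ℤ.* a ℤ.- a ℤ.+ + 1 , + 2 ℤ.- a ⟩

      private
        evalAt-γ : evalAt ρ γ̂ ≈ γ
        evalAt-γ = trans (reflexive (cong (evalAt ρ) γ-embed))
          (trans (evalAt-b (a ℤ.+ + 12) (a ℤ.+ + 1) (a ℤ.- + 2))
            (+-cong (+-cong (ι-+ a (+ 12)) (*-congʳ (ι-+ a (+ 1)))) (-‿cong (*-congʳ ι-a-2))))

        evalAt-γ′ : evalAt ρ′ γ̂ ≈ γ′
        evalAt-γ′ = trans (reflexive (cong (evalAt ρ′) γ-embed))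
          (trans (evalAt-b′ (a ℤ.+ + 12) (a ℤ.+ + 1) (a ℤ.- + 2))
            (+-cong (+-cong (ι-+ a (+ 12)) (-‿cong (*-congʳ (ι-+ a (+ 1)))))
              (-‿cong (*-congʳ ι-a-2))))

        evalAt-γ″ : evalAt ρ″ γ̂ ≈ γ″
        evalAt-γ″ = trans (reflexive (cong (evalAt ρ″) γ-embed))
          (trans (evalAt-b″ (a ℤ.+ + 12) (a ℤ.+ + 1) (a ℤ.- + 2))
            (+-cong (+-cong (ι-+ a (+ 12)) (-‿cong (*-congʳ (ι-+ a (+ 1))))) (*-congʳ ι-a-2)))

      -- Phrased through upper bounds C, the condition covers both alternatives of `_⪰_`, strict
      -- inequality and equality, without a weak order on the reals.
      SquareBelowγ : Carrier → ℤ[ρ] → Set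
      SquareBelowγ x β = ∀ {C} → Pos (C - evalAt x γ̂) → Pos (C - evalAt x (times β β))

      private
        two-sided : ∀ {x g c B} β → SquareBelowγ x β → cubic A x ≈ ι (+ 0) →
                    evalAt x γ̂ ≈ g → evalAt x β ≈ c → Pos B → Pos (B ² - g) →
                    Pos (B - c) × Pos (B + c)
        two-sided {x} {g} {c} {B} β below root-x γ≈g β≈c B>0 g<B² =
            sqrt-bound B>0 c²<B²
          , pos-resp (solve 2 (λ B c → B :- (:- c) := B :+ c) refl B c)
              (sqrt-bound B>0 (pos-resp
                (solve 2 (λ B c → B :* B :- c :* c := B :* B :- (:- c) :* (:- c)) refl B c) c²<B²))
          where
          c²<B² : Pos (B ² - c ²)
          c²<B² = pos-resp
            (+-congˡ (-‿cong (trans (evalAt-square root-x β) (*-cong β≈c β≈c))))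
            (below (pos-resp (+-congˡ (-‿cong (sym γ≈g))) g<B²))

      candidates : ∀ x y z → let β = embed x y z in
        SquareBelowγ ρ β → SquareBelowγ ρ′ β → SquareBelowγ ρ″ β →
        Candidate x y z ⊎ Candidate (ℤ.- x) (ℤ.- y) (ℤ.- z)
      candidates x y z below below′ below″ =
        let β = embed x y z
            b<B , -B<b = two-sided β below cubic₀ evalAt-γ (evalAt-b x y z) B>0 γ<B²
            b′<B′ , -B′<b′ = two-sided β below′ cubic′ evalAt-γ′ (evalAt-b′ x y z) B′>0 γ′<B′²
            b″<B″ , -B″<b″ = two-sided β below″ cubic″ evalAt-γ″ (evalAt-b″ x y z) B″>0 γ″<B″²
        in classify (small b<B -B<b b′<B′ -B′<b′ b″<B″ -B″<b″)

      private
        square-embed : ∀ x y z → let β = embed x y z in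
                       evalAt ρ (times β β) ≈ (ι x + ι y * ρ + ι z * ρ′) ²
        square-embed x y z = trans (evalAt-square cubic₀ (embed x y z))
          (*-cong (evalAt-embed next-ρ x y z) (evalAt-embed next-ρ x y z))

        ρ′ρ″ρ≈1 : ρ′ * ρ″ * ρ ≈ ι (+ 1)
        ρ′ρ″ρ≈1 = trans (solve 3 (λ u v w → v :* w :* u := u :* v :* w) refl ρ ρ′ ρ″) ρρ′ρ″≈1

        ρ″ρρ′≈1 : ρ″ * ρ * ρ′ ≈ ι (+ 1)
        ρ″ρρ′≈1 = trans (solve 3 (λ u v w → w :* u :* v := u :* v :* w) refl ρ ρ′ ρ″) ρρ′ρ″≈1

      [ρ-1]²-product : ρ′ ² * ρ″ ² * (- ρ + ρ ²) ² ≈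
        evalAt ρ (times (embed -[1+ 0 ] (+ 1) (+ 0)) (embed -[1+ 0 ] (+ 1) (+ 0)))
      [ρ-1]²-product = trans (*-congˡ (*-cong 1*ρ 1*ρ)) (trans
        (square-product (ι (+ 1)) ρρ′ρ″≈1) (trans
        (solve 2 (λ u v → (u :- con (+ 1)) :* (u :- con (+ 1))
          := (con -[1+ 0 ] :+ con (+ 1) :* u :+ con (+ 0) :* v)
            :* (con -[1+ 0 ] :+ con (+ 1) :* u :+ con (+ 0) :* v)) refl ρ ρ′)
        (sym (square-embed -[1+ 0 ] (+ 1) (+ 0)))))
        where
        1*ρ : - ρ + ρ ² ≈ - (ι (+ 1) * ρ) + ρ ²
        1*ρ = solve 1 (λ u → :- u :+ u :* u := :- (con (+ 1) :* u) :+ u :* u) refl ρ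

      [ρ′-1]²-product : ρ″ ² * ρ ² * (- ρ′ + ρ′ ²) ² ≈
        evalAt ρ (times (embed -[1+ 0 ] (+ 0) (+ 1)) (embed -[1+ 0 ] (+ 0) (+ 1)))
      [ρ′-1]²-product = trans (*-congˡ (*-cong 1*ρ′ 1*ρ′)) (trans
        (square-product (ι (+ 1)) ρ′ρ″ρ≈1) (trans
        (solve 2 (λ u v → (v :- con (+ 1)) :* (v :- con (+ 1))
          := (con -[1+ 0 ] :+ con (+ 0) :* u :+ con (+ 1) :* v)
            :* (con -[1+ 0 ] :+ con (+ 0) :* u :+ con (+ 1) :* v)) refl ρ ρ′)
        (sym (square-embed -[1+ 0 ] (+ 0) (+ 1)))))
        where
        1*ρ′ : - ρ′ + ρ′ ² ≈ - (ι (+ 1) * ρ′) + ρ′ ²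
        1*ρ′ = solve 1 (λ u → :- u :+ u :* u := :- (con (+ 1) :* u) :+ u :* u) refl ρ′

      [ρ′-2]²-product : ρ″ ² * ρ ² * (- (ι (+ 2) * ρ′) + ρ′ ²) ² ≈
        evalAt ρ (times (embed -[1+ 1 ] (+ 0) (+ 1)) (embed -[1+ 1 ] (+ 0) (+ 1)))
      [ρ′-2]²-product = trans (square-product (ι (+ 2)) ρ′ρ″ρ≈1) (trans
        (solve 2 (λ u v → (v :- con (+ 2)) :* (v :- con (+ 2))
          := (con -[1+ 1 ] :+ con (+ 0) :* u :+ con (+ 1) :* v)
            :* (con -[1+ 1 ] :+ con (+ 0) :* u :+ con (+ 1) :* v)) refl ρ ρ′)
        (sym (square-embed -[1+ 1 ] (+ 0) (+ 1))))

      -- The trace is a, hence ρ″ - (a - 1) = -(ρ + ρ′ - 1), and the sign is lost in the square.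
      [ρ+ρ′-1]²-product : ρ ² * ρ′ ² * (- (ι (a ℤ.- + 1) * ρ″) + ρ″ ²) ² ≈
        evalAt ρ (times (embed -[1+ 0 ] (+ 1) (+ 1)) (embed -[1+ 0 ] (+ 1) (+ 1)))
      [ρ+ρ′-1]²-product = trans (square-product (ι (a ℤ.- + 1)) ρ″ρρ′≈1) (trans
        (trans (*-cong -root -root)
          (solve 1 (λ v → (:- v) :* (:- v) := v :* v) refl
            (ι -[1+ 0 ] + ι (+ 1) * ρ + ι (+ 1) * ρ′)))
        (sym (square-embed -[1+ 0 ] (+ 1) (+ 1))))
        where
        -root : ρ″ - ι (a ℤ.- + 1) ≈ - (ι -[1+ 0 ] + ι (+ 1) * ρ + ι (+ 1) * ρ′)
        -root = trans (+-congˡ (-‿cong (trans (ι-+ a (ℤ.- (+ 1))) (+-congˡ (ι-neg (+ 1)))))) (trans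
          (solve 2 (λ A w → w :- (A :- con (+ 1)) := :- (A :- w) :+ con (+ 1)) refl A ρ″) (trans
          (+-congʳ (-‿cong A-ρ″≈ρ+ρ′))
          (solve 2 (λ u v → :- (u :+ v) :+ con (+ 1)
            := :- (con -[1+ 0 ] :+ con (+ 1) :* u :+ con (+ 1) :* v)) refl ρ ρ′)))

open import Defs
open ≡ using (refl; sym; trans)

-- The Cauchy reals form such an ordered ring.

Eventually : (ℕ → Set) → Set
Eventually P = ∃[ N ] (∀ n → N ℕ.≤ n → P n)

eventually-zip : ∀ {P Q R : ℕ → Set} → (∀ n → P n → Q n → R n) →
                 Eventually P → Eventually Q → Eventually R
eventually-zip f (M , p) (N , q) = M ℕ.⊔ N , λ n n≥ →
  f n (p n (ℕₚ.m⊔n≤o⇒m≤o M N n≥)) (q n (ℕₚ.m⊔n≤o⇒n≤o M N n≥))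

eventually-map : ∀ {P Q : ℕ → Set} → (∀ n → P n → Q n) →
                 Eventually P → Eventually Q
eventually-map f (N , p) = N , λ n n≥ → f n (p n n≥)

*-pos : ∀ {p q} → 0ℚ ℚ.< p → 0ℚ ℚ.< q → 0ℚ ℚ.< p ℚ.* q
*-pos {p} {q} 0<p 0<q = subst (ℚ._< p ℚ.* q) (ℚₚ.*-zeroʳ p)
  (ℚₚ.*-monoʳ-<-pos p {{ℚ.positive 0<p}} 0<q)

quotient : ∀ {B ε} → 0ℚ ℚ.< B → 0ℚ ℚ.< ε → ∃[ δ ] 0ℚ ℚ.< δ × B ℚ.* δ ≡ ε
quotient {B} {ε} 0<B 0<ε = 1/ B ℚ.* ε
  , *-pos (ℚₚ.positive⁻¹ (1/ B) {{ℚₚ.1/pos⇒pos B}}) 0<ε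
  , trans (sym (ℚₚ.*-assoc B (1/ B) ε))
      (trans (cong (ℚ._* ε) (ℚₚ.*-inverseʳ B)) (ℚₚ.*-identityˡ ε))
  where
  instance
    posB : ℚ.Positive B
    posB = ℚ.positive 0<B
    nzB : ℚ.NonZero B
    nzB = ℚₚ.pos⇒nonZero B

0<½* : ∀ {ε} → 0ℚ ℚ.< ε → 0ℚ ℚ.< ½ ℚ.* ε
0<½* = *-pos (ℚₚ.positive⁻¹ ½)

½+½ : ∀ ε → ½ ℚ.* ε ℚ.+ ½ ℚ.* ε ≡ ε
½+½ ε = trans (sym (ℚₚ.*-distribʳ-+ ε ½ ½)) (ℚₚ.*-identityˡ ε)

½*< : ∀ {ε} → 0ℚ ℚ.< ε → ½ ℚ.* ε ℚ.< ε
½*< {ε} 0<ε = subst₂ ℚ._<_ (ℚₚ.+-identityʳ (½ ℚ.* ε)) (½+½ ε)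
  (ℚₚ.+-monoʳ-< (½ ℚ.* ε) (0<½* 0<ε))

0≤p² : ∀ p → 0ℚ ℚ.≤ p ℚ.* p
0≤p² p = subst (0ℚ ℚ.≤_) (∣p∣² p) 0≤∣p∣²
  where
  ∣p∣² : ∀ p → ∣ p ∣ ℚ.* ∣ p ∣ ≡ p ℚ.* p
  ∣p∣² p with ℚₚ.∣p∣≡p∨∣p∣≡-p p
  ... | inj₁ eq = cong₂ ℚ._*_ eq eq
  ... | inj₂ eq = trans (cong₂ ℚ._*_ eq eq) (neg² p)
    where
    open +-*-Solver
    neg² : ∀ p → (ℚ.- p) ℚ.* (ℚ.- p) ≡ p ℚ.* p
    neg² = solve 1 (λ p → (:- p) :* (:- p) := p :* p) refl
  0≤∣p∣² : 0ℚ ℚ.≤ ∣ p ∣ ℚ.* ∣ p ∣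
  0≤∣p∣² = subst (ℚ._≤ ∣ p ∣ ℚ.* ∣ p ∣) (ℚₚ.*-zeroʳ ∣ p ∣)
    (ℚₚ.*-monoˡ-≤-nonNeg ∣ p ∣ {{ℚₚ.∣-∣-nonNeg p}} (ℚₚ.0≤∣p∣ p))

p≤∣p∣ : ∀ p → p ℚ.≤ ∣ p ∣
p≤∣p∣ p with ℚₚ.≤-total 0ℚ p
... | inj₁ 0≤p = ℚₚ.≤-reflexive (sym (ℚₚ.0≤p⇒∣p∣≡p 0≤p))
... | inj₂ p≤0 = ℚₚ.≤-trans p≤0 (ℚₚ.0≤∣p∣ p)

-- Equality of reals says that the termwise difference is null. The congruence laws thus reduce to
-- closure of null sequences under sums, negation and bounded factors.
Null : (ℕ → ℚ) → Set
Null d = ∀ ε → 0ℚ ℚ.< ε → Eventually (λ n → ∣ d n ∣ ℚ.< ε)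

EventuallyBounded : (ℕ → ℚ) → Set
EventuallyBounded x = ∃[ B ] 0ℚ ℚ.< B × Eventually (λ n → ∣ x n ∣ ℚ.≤ B)

null-0 : ∀ {d} → (∀ n → d n ≡ 0ℚ) → Null d
null-0 d≡0 ε 0<ε = 0 , λ n _ → subst (ℚ._< ε) (sym (cong ∣_∣ (d≡0 n))) 0<ε

null-resp : ∀ {d e} → (∀ n → d n ≡ e n) → Null d → Null e
null-resp d≡e null ε 0<ε =
  eventually-map (λ n → subst (λ q → ∣ q ∣ ℚ.< ε) (d≡e n)) (null ε 0<ε)

null-+ : ∀ {d e} → Null d → Null e → Null (λ n → d n ℚ.+ e n)
null-+ {d} {e} nd ne ε 0<ε =
  eventually-zip
    (λ n p q → ℚₚ.≤-<-trans (ℚₚ.∣p+q∣≤∣p∣+∣q∣ (d n) (e n))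
      (subst (∣ d n ∣ ℚ.+ ∣ e n ∣ ℚ.<_) (½+½ ε) (ℚₚ.+-mono-< p q)))
    (nd (½ ℚ.* ε) (0<½* 0<ε)) (ne (½ ℚ.* ε) (0<½* 0<ε))

null-neg : ∀ {d} → Null d → Null (λ n → ℚ.- d n)
null-neg {d} nd ε 0<ε =
  eventually-map (λ n → subst (ℚ._< ε) (sym (ℚₚ.∣-p∣≡∣p∣ (d n)))) (nd ε 0<ε)

null-* : ∀ {x d} → EventuallyBounded x → Null d → Null (λ n → x n ℚ.* d n)
null-* {x} {d} (B , 0<B , x≤B) nd ε 0<ε with quotient 0<B 0<ε
... | δ , 0<δ , Bδ≡ε = eventually-zip step x≤B (nd δ 0<δ)
  where
  open ≤-Reasoning
  step : ∀ n → ∣ x n ∣ ℚ.≤ B → ∣ d n ∣ ℚ.< δ → ∣ x n ℚ.* d n ∣ ℚ.< ε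
  step n p q = begin-strict
    ∣ x n ℚ.* d n ∣      ≡⟨ ℚₚ.∣p*q∣≡∣p∣*∣q∣ (x n) (d n) ⟩
    ∣ x n ∣ ℚ.* ∣ d n ∣  ≤⟨ ℚₚ.*-monoʳ-≤-nonNeg ∣ d n ∣ {{ℚₚ.∣-∣-nonNeg (d n)}} p ⟩
    B ℚ.* ∣ d n ∣        <⟨ ℚₚ.*-monoʳ-<-pos B {{ℚ.positive 0<B}} q ⟩
    B ℚ.* δ              ≡⟨ Bδ≡ε ⟩
    ε                    ∎

bounded : ∀ x → EventuallyBounded (seq x)
bounded (mkℝ x cx) with cx 1ℚ (ℚₚ.positive⁻¹ 1ℚ)
... | N , p = 1ℚ ℚ.+ ∣ x N ∣
            , ℚₚ.+-mono-<-≤ (ℚₚ.positive⁻¹ 1ℚ) (ℚₚ.0≤∣p∣ (x N))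
            , N , λ n n≥ → begin
    ∣ x n ∣                        ≡⟨ cong ∣_∣ (split (x n) (x N)) ⟩
    ∣ (x n ℚ.- x N) ℚ.+ x N ∣      ≤⟨ ℚₚ.∣p+q∣≤∣p∣+∣q∣ (x n ℚ.- x N) (x N) ⟩
    ∣ x n ℚ.- x N ∣ ℚ.+ ∣ x N ∣    ≤⟨ ℚₚ.+-monoˡ-≤ ∣ x N ∣ (ℚₚ.<⇒≤ (p n N n≥ ℕₚ.≤-refl)) ⟩
    1ℚ ℚ.+ ∣ x N ∣                 ∎
  where
  open ≤-Reasoning
  open +-*-Solver
  split : ∀ a b → a ≡ (a ℚ.- b) ℚ.+ b
  split = solve 2 (λ a b → a := (a :- b) :+ b) refl

null⇒≃ : ∀ {x y} → Null (λ n → seq x n ℚ.- seq y n) → x ≃ y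
null⇒≃ null = mk≃ null

≃⇒null : ∀ {x y} → x ≃ y → Null (λ n → seq x n ℚ.- seq y n)
≃⇒null = _≃_.close

termwise : ∀ {x y} → (∀ n → seq x n ≡ seq y n) → x ≃ y
termwise {x} {y} eq = null⇒≃ (null-0 λ n →
  trans (cong (ℚ._- seq y n) (eq n)) (ℚₚ.+-inverseʳ (seq y n)))

≃-refl : ∀ {x} → x ≃ x
≃-refl = termwise λ _ → refl

module _ where
  open +-*-Solver

  ≃-sym : ∀ {x y} → x ≃ y → y ≃ x
  ≃-sym {x} {y} p = null⇒≃ (null-resp (λ n → eq (seq x n) (seq y n)) (null-neg (≃⇒null p)))
    where
    eq : ∀ a b → ℚ.- (a ℚ.- b) ≡ b ℚ.- a
    eq = solve 2 (λ a b → :- (a :- b) := b :- a) refl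

  ≃-trans : ∀ {x y z} → x ≃ y → y ≃ z → x ≃ z
  ≃-trans {x} {y} {z} p q = null⇒≃ (null-resp (λ n → eq (seq x n) (seq y n) (seq z n))
    (null-+ (≃⇒null p) (≃⇒null q)))
    where
    eq : ∀ a b c → (a ℚ.- b) ℚ.+ (b ℚ.- c) ≡ a ℚ.- c
    eq = solve 3 (λ a b c → (a :- b) :+ (b :- c) := a :- c) refl

infixl 6 _+ᵣ_
infixl 7 _*ᵣ_
infix  8 -ᵣ_

-- Opaque, since otherwise comparing two real expressions makes Agda normalise the proofs that
-- they are Cauchy.
opaque
  _+ᵣ_ _*ᵣ_ : ℝ → ℝ → ℝ
  x +ᵣ y = x + y
  x *ᵣ y = x * y

  -ᵣ_ : ℝ → ℝ
  -ᵣ x = - x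

  fromℤᵣ : ℤ → ℝ
  fromℤᵣ k = fromℤ k

opaque
  unfolding _+ᵣ_
  open +-*-Solver

  +ᵣ-cong : ∀ {x y u v} → x ≃ y → u ≃ v → x +ᵣ u ≃ y +ᵣ v
  +ᵣ-cong {x} {y} {u} {v} p q = null⇒≃
    (null-resp (λ n → eq (seq x n) (seq y n) (seq u n) (seq v n))
      (null-+ (≃⇒null p) (≃⇒null q)))
    where
    eq : ∀ a b c d → (a ℚ.- b) ℚ.+ (c ℚ.- d) ≡ (a ℚ.+ c) ℚ.- (b ℚ.+ d)
    eq = solve 4 (λ a b c d → (a :- b) :+ (c :- d) := (a :+ c) :- (b :+ d)) refl

  -ᵣ-cong : ∀ {x y} → x ≃ y → -ᵣ x ≃ -ᵣ y
  -ᵣ-cong {x} {y} p = null⇒≃ (null-resp (λ n → eq (seq x n) (seq y n)) (null-neg (≃⇒null p)))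
    where
    eq : ∀ a b → ℚ.- (a ℚ.- b) ≡ (ℚ.- a) ℚ.- (ℚ.- b)
    eq = solve 2 (λ a b → :- (a :- b) := (:- a) :- (:- b)) refl

  *ᵣ-cong : ∀ {x y u v} → x ≃ y → u ≃ v → x *ᵣ u ≃ y *ᵣ v
  *ᵣ-cong {x} {y} {u} {v} p q = null⇒≃
    (null-resp (λ n → eq (seq x n) (seq y n) (seq u n) (seq v n))
      (null-+ (null-* (bounded u) (≃⇒null p)) (null-* (bounded y) (≃⇒null q))))
    where
    eq : ∀ a b c d → c ℚ.* (a ℚ.- b) ℚ.+ b ℚ.* (c ℚ.- d) ≡ a ℚ.* c ℚ.- b ℚ.* d
    eq = solve 4 (λ a b c d → c :* (a :- b) :+ b :* (c :- d) := a :* c :- b :* d) refl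

  +ᵣ-assoc : ∀ x y z → (x +ᵣ y) +ᵣ z ≃ x +ᵣ (y +ᵣ z)
  +ᵣ-assoc x y z = termwise λ n → ℚₚ.+-assoc (seq x n) (seq y n) (seq z n)

  +ᵣ-comm : ∀ x y → x +ᵣ y ≃ y +ᵣ x
  +ᵣ-comm x y = termwise λ n → ℚₚ.+-comm (seq x n) (seq y n)

  +ᵣ-identityˡ : ∀ x → fromℤᵣ (+ 0) +ᵣ x ≃ x
  +ᵣ-identityˡ x = termwise λ n → ℚₚ.+-identityˡ (seq x n)

  -ᵣ-inverseˡ : ∀ x → -ᵣ x +ᵣ x ≃ fromℤᵣ (+ 0)
  -ᵣ-inverseˡ x = termwise λ n → ℚₚ.+-inverseˡ (seq x n)

  *ᵣ-assoc : ∀ x y z → (x *ᵣ y) *ᵣ z ≃ x *ᵣ (y *ᵣ z)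
  *ᵣ-assoc x y z = termwise λ n → ℚₚ.*-assoc (seq x n) (seq y n) (seq z n)

  *ᵣ-comm : ∀ x y → x *ᵣ y ≃ y *ᵣ x
  *ᵣ-comm x y = termwise λ n → ℚₚ.*-comm (seq x n) (seq y n)

  *ᵣ-identityˡ : ∀ x → fromℤᵣ (+ 1) *ᵣ x ≃ x
  *ᵣ-identityˡ x = termwise λ n → ℚₚ.*-identityˡ (seq x n)

  *ᵣ-distribˡ-+ᵣ : ∀ x y z → x *ᵣ (y +ᵣ z) ≃ (x *ᵣ y) +ᵣ (x *ᵣ z)
  *ᵣ-distribˡ-+ᵣ x y z = termwise λ n → ℚₚ.*-distribˡ-+ (seq x n) (seq y n) (seq z n)

  fromℤ⇒fromℤᵣ : ∀ k → fromℤ k ≃ fromℤᵣ k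
  fromℤ⇒fromℤᵣ k = ≃-refl

  +⇒+ᵣ : ∀ x y {x′ y′} → x ≃ x′ → y ≃ y′ → x + y ≃ x′ +ᵣ y′
  +⇒+ᵣ x y = +ᵣ-cong

  -⇒-ᵣ : ∀ x {x′} → x ≃ x′ → - x ≃ -ᵣ x′
  -⇒-ᵣ x = -ᵣ-cong

  *⇒*ᵣ : ∀ x y {x′ y′} → x ≃ x′ → y ≃ y′ → x * y ≃ x′ *ᵣ y′
  *⇒*ᵣ x y = *ᵣ-cong

minus⇒-ᵣ : ∀ x y {x′ y′} → x ≃ x′ → y ≃ y′ → x - y ≃ x′ +ᵣ -ᵣ y′
minus⇒-ᵣ x y p q = +⇒+ᵣ x (- y) p (-⇒-ᵣ y q)

²⇒*ᵣ : ∀ x {x′} → x ≃ x′ → x ² ≃ x′ *ᵣ x′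
²⇒*ᵣ x p = *⇒*ᵣ x x p p

³⇒*ᵣ : ∀ x {x′} → x ≃ x′ → x ³ ≃ x′ *ᵣ x′ *ᵣ x′
³⇒*ᵣ x p = *⇒*ᵣ (x * x) x (*⇒*ᵣ x x p p) p

-- The operation `ℚ._/_` reduces by a gcd, which blocks computation for variable numerators. In the
-- unnormalised rationals the statement is a comparison of fractions with denominator 1, and `toℚᵘ`
-- is injective.
fromℤ-homo : (_∙_ : ℤ → ℤ → ℤ) (_∘_ : ℚ → ℚ → ℚ) (_∘ᵘ_ : ℚᵘ.ℚᵘ → ℚᵘ.ℚᵘ → ℚᵘ.ℚᵘ) →
  (∀ p q → ℚ.toℚᵘ (p ∘ q) ℚᵘ.≃ ℚ.toℚᵘ p ∘ᵘ ℚ.toℚᵘ q) →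
  (∀ {p q u v} → p ℚᵘ.≃ q → u ℚᵘ.≃ v → p ∘ᵘ u ℚᵘ.≃ q ∘ᵘ v) →
  (∀ m n → ℚᵘ.mkℚᵘ (m ∙ n) 0 ℚᵘ.≃ ℚᵘ.mkℚᵘ m 0 ∘ᵘ ℚᵘ.mkℚᵘ n 0) →
  ∀ m n → (m ∙ n) ℚ./ 1 ≡ (m ℚ./ 1) ∘ (n ℚ./ 1)
fromℤ-homo _∙_ _∘_ _∘ᵘ_ homo congᵘ step m n = ℚₚ.toℚᵘ-injective (begin
  ℚ.toℚᵘ ((m ∙ n) ℚ./ 1)                   ≈⟨ ℚₚ.toℚᵘ-fromℚᵘ (ℚᵘ.mkℚᵘ (m ∙ n) 0) ⟩
  ℚᵘ.mkℚᵘ (m ∙ n) 0                        ≈⟨ step m n ⟩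
  ℚᵘ.mkℚᵘ m 0 ∘ᵘ ℚᵘ.mkℚᵘ n 0
    ≈⟨ congᵘ (ℚₚ.toℚᵘ-fromℚᵘ (ℚᵘ.mkℚᵘ m 0)) (ℚₚ.toℚᵘ-fromℚᵘ (ℚᵘ.mkℚᵘ n 0)) ⟨
  ℚ.toℚᵘ (m ℚ./ 1) ∘ᵘ ℚ.toℚᵘ (n ℚ./ 1)     ≈⟨ homo (m ℚ./ 1) (n ℚ./ 1) ⟨
  ℚ.toℚᵘ ((m ℚ./ 1) ∘ (n ℚ./ 1))           ∎)
  where open ℚᵘₚ.≃-Reasoning

opaque
  unfolding _+ᵣ_

  fromℤᵣ-+ : ∀ m n → fromℤᵣ (m ℤ.+ n) ≃ fromℤᵣ m +ᵣ fromℤᵣ n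
  fromℤᵣ-+ m n = termwise λ _ → fromℤ-homo ℤ._+_ ℚ._+_ ℚᵘ._+_ ℚₚ.toℚᵘ-homo-+ ℚᵘₚ.+-cong
    (λ m n → ℚᵘ.*≡* (cong (ℤ._* + 1)
      (sym (cong₂ ℤ._+_ (ℤₚ.*-identityʳ m) (ℤₚ.*-identityʳ n))))) m n

  fromℤᵣ-* : ∀ m n → fromℤᵣ (m ℤ.* n) ≃ fromℤᵣ m *ᵣ fromℤᵣ n
  fromℤᵣ-* m n = termwise λ _ → fromℤ-homo ℤ._*_ ℚ._*_ ℚᵘ._*_ ℚₚ.toℚᵘ-homo-* ℚᵘₚ.*-cong
    (λ m n → ℚᵘ.*≡* refl) m n

ℝ-commutativeRing : CommutativeRing 0ℓ 0ℓ
ℝ-commutativeRing = record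
  { Carrier = ℝ ; _≈_ = _≃_ ; _+_ = _+ᵣ_ ; _*_ = _*ᵣ_ ; -_ = -ᵣ_
  ; 0# = fromℤᵣ (+ 0) ; 1# = fromℤᵣ (+ 1)
  ; isCommutativeRing = record
    { isRing = record
      { +-isAbelianGroup = record
        { isGroup = record
          { isMonoid = record
            { isSemigroup = record
              { isMagma = record
                { isEquivalence = isEquivalence ; ∙-cong = +ᵣ-cong }
              ; assoc = +ᵣ-assoc }
            ; identity = comm∧idˡ⇒id +ᵣ-comm +ᵣ-identityˡ }
          ; inverse = comm∧invˡ⇒inv +ᵣ-comm -ᵣ-inverseˡ
          ; ⁻¹-cong = -ᵣ-cong }
        ; comm = +ᵣ-comm }
      ; *-cong = *ᵣ-cong
      ; *-assoc = *ᵣ-assoc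
      ; *-identity = comm∧idˡ⇒id *ᵣ-comm *ᵣ-identityˡ
      ; distrib = comm∧distrˡ⇒distr +ᵣ-cong *ᵣ-comm *ᵣ-distribˡ-+ᵣ }
    ; *-comm = *ᵣ-comm } }
  where
  isEquivalence : IsEquivalence _≃_
  isEquivalence = record { refl = ≃-refl ; sym = ≃-sym ; trans = ≃-trans }
  setoid : Setoid 0ℓ 0ℓ
  setoid = record { isEquivalence = isEquivalence }
  open Algebra.Consequences.Setoid setoid
    using (comm∧idˡ⇒id; comm∧invˡ⇒inv; comm∧distrˡ⇒distr)

record Pos (x : ℝ) : Set where
  constructor mkPos
  field
    gap     : ℚ
    gap-pos : 0ℚ ℚ.< gap
    above   : Eventually (λ n → gap ℚ.< seq x n)

pos-resp : ∀ {x y} → x ≃ y → Pos x → Pos y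
pos-resp {x} {y} x≃y (mkPos g 0<g g<x) = mkPos (½ ℚ.* g) (0<½* 0<g)
  (eventually-zip step (≃⇒null x≃y (½ ℚ.* g) (0<½* 0<g)) g<x)
  where
  open ≤-Reasoning
  open +-*-Solver
  cancel : ∀ d → ℚ.- d ℚ.+ (d ℚ.+ d) ≡ d
  cancel = solve 1 (λ d → :- d :+ (d :+ d) := d) refl
  move : ∀ x y → ℚ.- (x ℚ.- y) ℚ.+ x ≡ y
  move = solve 2 (λ x y → :- (x :- y) :+ x := y) refl
  step : ∀ n → ∣ seq x n ℚ.- seq y n ∣ ℚ.< ½ ℚ.* g → g ℚ.< seq x n → ½ ℚ.* g ℚ.< seq y n
  step n d<h g<xn = begin-strict
    ½ ℚ.* g                                  ≡⟨ cancel (½ ℚ.* g) ⟨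
    ℚ.- (½ ℚ.* g) ℚ.+ (½ ℚ.* g ℚ.+ ½ ℚ.* g)  ≡⟨ cong (ℚ.- (½ ℚ.* g) ℚ.+_) (½+½ g) ⟩
    ℚ.- (½ ℚ.* g) ℚ.+ g
      <⟨ ℚₚ.+-mono-< (ℚₚ.neg-antimono-< (ℚₚ.≤-<-trans (p≤∣p∣ _) d<h)) g<xn ⟩
    ℚ.- (seq x n ℚ.- seq y n) ℚ.+ seq x n    ≡⟨ move (seq x n) (seq y n) ⟩
    seq y n                                  ∎

-- By contraposition: y ≤ δ would give xy ≤ xδ ≤ Bδ.
factor-< : ∀ {B δ x y} → 0ℚ ℚ.< x → 0ℚ ℚ.< δ → x ℚ.≤ B → B ℚ.* δ ℚ.< x ℚ.* y → δ ℚ.< y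
factor-< {B} {δ} {x} {y} 0<x 0<δ x≤B Bδ<xy = ℚₚ.≰⇒> λ y≤δ →
  ℚₚ.<-irrefl refl (ℚₚ.<-≤-trans Bδ<xy (ℚₚ.≤-trans
    (ℚₚ.*-monoˡ-≤-nonNeg x {{ℚ.nonNegative (ℚₚ.<⇒≤ 0<x)}} y≤δ)
    (ℚₚ.*-monoʳ-≤-nonNeg δ {{ℚ.nonNegative (ℚₚ.<⇒≤ 0<δ)}} x≤B)))

opaque
  unfolding _+ᵣ_

  pos-irrefl : ¬ Pos (fromℤᵣ (+ 0))
  pos-irrefl (mkPos g 0<g (N , g<0)) = ℚₚ.<-irrefl refl (ℚₚ.<-trans 0<g (g<0 N ℕₚ.≤-refl))

  pos-1 : Pos (fromℤᵣ (+ 1))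
  pos-1 = mkPos ½ (ℚₚ.positive⁻¹ ½) (0 , λ _ _ → ½*< (ℚₚ.positive⁻¹ 1ℚ))

  pos-+ : ∀ {x y} → Pos x → Pos y → Pos (x +ᵣ y)
  pos-+ (mkPos g 0<g g<x) (mkPos h 0<h h<y) =
    mkPos (g ℚ.+ h) (ℚₚ.+-mono-< 0<g 0<h) (eventually-zip (λ n → ℚₚ.+-mono-<) g<x h<y)

  pos-* : ∀ {x y} → Pos x → Pos y → Pos (x *ᵣ y)
  pos-* {x} {y} (mkPos g 0<g g<x) (mkPos h 0<h h<y) =
    mkPos (g ℚ.* h) (*-pos 0<g 0<h) (eventually-zip step g<x h<y)
    where
    step : ∀ n → g ℚ.< seq x n → h ℚ.< seq y n → g ℚ.* h ℚ.< seq x n ℚ.* seq y n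
    step n g<xn h<yn = ℚₚ.<-trans
      (ℚₚ.*-monoʳ-<-pos g {{ℚ.positive 0<g}} h<yn)
      (ℚₚ.*-monoˡ-<-pos (seq y n) {{ℚ.positive (ℚₚ.<-trans 0<h h<yn)}} g<xn)

  pos-+-² : ∀ {x} y → Pos x → Pos (x +ᵣ y *ᵣ y)
  pos-+-² {x} y (mkPos g 0<g g<x) = mkPos g 0<g (eventually-map step g<x)
    where
    step : ∀ n → g ℚ.< seq x n → g ℚ.< seq x n ℚ.+ seq y n ℚ.* seq y n
    step n g<xn = subst (ℚ._< seq x n ℚ.+ seq y n ℚ.* seq y n) (ℚₚ.+-identityʳ g)
      (ℚₚ.+-mono-<-≤ g<xn (0≤p² (seq y n)))

  -- A Cauchy sequence is bounded, so a gap h for the product leaves the uniform gap h/B for y,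
  -- where B bounds x.
  pos-cancel : ∀ {x y} → Pos x → Pos (x *ᵣ y) → Pos y
  pos-cancel {x} {y} (mkPos g 0<g g<x) (mkPos h 0<h h<xy) =
    let B , 0<B , x≤B = bounded x
        δ , 0<δ , Bδ≡h = quotient 0<B 0<h
    in mkPos δ 0<δ (eventually-zip (λ n f → f)
         (eventually-zip
           (λ n g<xn xn≤B h<xyn → factor-< (ℚₚ.<-trans 0<g g<xn) 0<δ
              (ℚₚ.≤-trans (p≤∣p∣ (seq x n)) xn≤B)
              (subst (ℚ._< seq x n ℚ.* seq y n) (sym Bδ≡h) h<xyn))
           g<x x≤B)
         h<xy)

  -- Here the gap g of x is what counts: eventually g times the absolute value of y is at most that
  -- of xy.
  ≃0-cancel : ∀ {x y} → Pos x → x *ᵣ y ≃ fromℤᵣ (+ 0) → y ≃ fromℤᵣ (+ 0)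
  ≃0-cancel {x} {y} (mkPos g 0<g g<x) xy≃0 = null⇒≃
    (null-resp (λ n → sym (ℚₚ.+-identityʳ (seq y n))) null-y)
    where
    null-xy : Null (λ n → seq x n ℚ.* seq y n)
    null-xy = null-resp (λ n → ℚₚ.+-identityʳ (seq x n ℚ.* seq y n)) (≃⇒null xy≃0)
    null-y : Null (seq y)
    null-y ε 0<ε = eventually-zip step g<x (null-xy (g ℚ.* ε) (*-pos 0<g 0<ε))
      where
      step : ∀ n → g ℚ.< seq x n → ∣ seq x n ℚ.* seq y n ∣ ℚ.< g ℚ.* ε → ∣ seq y n ∣ ℚ.< ε
      step n g<xn xyn<gε = ℚₚ.*-cancelˡ-<-nonNeg g {{ℚ.nonNegative (ℚₚ.<⇒≤ 0<g)}} (begin-strict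
        g ℚ.* ∣ seq y n ∣
          ≤⟨ ℚₚ.*-monoʳ-≤-nonNeg ∣ seq y n ∣ {{ℚₚ.∣-∣-nonNeg (seq y n)}}
               (ℚₚ.≤-trans (ℚₚ.<⇒≤ g<xn) (p≤∣p∣ (seq x n))) ⟩
        ∣ seq x n ∣ ℚ.* ∣ seq y n ∣  ≡⟨ ℚₚ.∣p*q∣≡∣p∣*∣q∣ (seq x n) (seq y n) ⟨
        ∣ seq x n ℚ.* seq y n ∣      <⟨ xyn<gε ⟩
        g ℚ.* ε ∎)
        where open ≤-Reasoning

  <⇒pos : ∀ {x y} → x < y → Pos (y +ᵣ -ᵣ x)
  <⇒pos {x} {y} (mk< g 0<g N below) = mkPos (½ ℚ.* g) (0<½* 0<g) (N , λ n n≥ →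
    ℚₚ.<-trans (½*< 0<g)
      (subst (ℚ._< seq y n ℚ.- seq x n) (cancel (seq x n) g)
        (ℚₚ.+-monoˡ-< (ℚ.- seq x n) (below n n≥))))
    where
    open +-*-Solver
    cancel : ∀ x g → (x ℚ.+ g) ℚ.- x ≡ g
    cancel = solve 2 (λ x g → (x :+ g) :- x := g) refl

  pos⇒< : ∀ {x y} → Pos (y +ᵣ -ᵣ x) → x < y
  pos⇒< {x} {y} (mkPos g 0<g (N , g<y-x)) = mk< g 0<g N λ n n≥ →
    subst (seq x n ℚ.+ g ℚ.<_) (cancel (seq x n) (seq y n)) (ℚₚ.+-monoʳ-< (seq x n) (g<y-x n n≥))
    where
    open +-*-Solver
    cancel : ∀ x y → x ℚ.+ (y ℚ.- x) ≡ y
    cancel = solve 2 (λ x y → x :+ (y :- x) := y) refl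

ℝ-orderedRing : OrderedRing
ℝ-orderedRing = record
  { commutativeRing = ℝ-commutativeRing
  ; ι = fromℤᵣ ; ι-+ = fromℤᵣ-+ ; ι-* = fromℤᵣ-* ; ι-0 = ≃-refl ; ι-1 = ≃-refl
  ; Pos = Pos
  ; pos-resp = λ {x} {y} → pos-resp {x} {y}
  ; pos-+ = λ {x} {y} → pos-+ {x} {y}
  ; pos-* = λ {x} {y} → pos-* {x} {y}
  ; pos-+-² = λ {x} y → pos-+-² {x} y
  ; pos-1 = pos-1 ; pos-irrefl = pos-irrefl
  ; pos-cancel = λ {x} {y} → pos-cancel {x} {y}
  ; ≈0-cancel = λ {x} {y} → ≃0-cancel {x} {y} }

module ℝ-properties = OrderedRingProperties ℝ-orderedRing

fromℤ<⇒pos : ∀ {k x} → fromℤ k < x → Pos (x +ᵣ -ᵣ fromℤᵣ k)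
fromℤ<⇒pos {k} k<x =
  pos-resp (+ᵣ-cong ≃-refl (-ᵣ-cong (fromℤ⇒fromℤᵣ k))) (<⇒pos k<x)

<fromℤ⇒pos : ∀ {k x} → x < fromℤ k → Pos (fromℤᵣ k +ᵣ -ᵣ x)
<fromℤ⇒pos {k} x<k = pos-resp (+ᵣ-cong (fromℤ⇒fromℤᵣ k) ≃-refl) (<⇒pos x<k)

-- The rational integers from -3 to 3.

HasSignℤ : Sign → ℤ → Set
HasSignℤ Sign.+ k = + 0 ℤ.< k
HasSignℤ Sign.- k = k ℤ.< + 0

positive-sign : ∀ {m n} s → HasSignℤ s (+ suc m) → HasSignℤ s (+ suc n)
positive-sign Sign.+ _ = ℤ.+<+ (ℕ.s≤s ℕ.z≤n)
positive-sign Sign.- (ℤ.+<+ ())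

negative-sign : ∀ {m n} s → HasSignℤ s -[1+ m ] → HasSignℤ s -[1+ n ]
negative-sign Sign.+ ()
negative-sign Sign.- _ = ℤ.-<+

nonzero-sign : ∀ s k → HasSignℤ s k → ¬ (k ≡ + 0)
nonzero-sign Sign.+ k 0<k k≡0 = ℤₚ.<-irrefl (sym k≡0) 0<k
nonzero-sign Sign.- k k<0 k≡0 = ℤₚ.<-irrefl k≡0 k<0

-- The reasons why k cannot be a non-unit indecomposable. In `sum` the sign is quantified, because
-- the signature σ is arbitrary and each of its components is matched separately.
data SmallInteger (k : ℤ) : Set where
  zero : k ≡ + 0 → SmallInteger k
  unit : k ℤ.* k ≡ + 1 → SmallInteger k
  sum  : ∀ l m → k ≡ l ℤ.+ m → (∀ s → HasSignℤ s k → HasSignℤ s l) →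
         (∀ s → HasSignℤ s k → HasSignℤ s m) → SmallInteger k

smallInteger : ∀ k → k ℤ.< + 4 → -[1+ 3 ] ℤ.< k → SmallInteger k
smallInteger (+ 0)    _ _ = zero refl
smallInteger (+ 1)    _ _ = unit refl
smallInteger (+ 2)    _ _ = sum (+ 1) (+ 1) refl positive-sign positive-sign
smallInteger (+ 3)    _ _ = sum (+ 1) (+ 2) refl positive-sign positive-sign
smallInteger -[1+ 0 ] _ _ = unit refl
smallInteger -[1+ 1 ] _ _ = sum -[1+ 0 ] -[1+ 0 ] refl negative-sign negative-sign
smallInteger -[1+ 2 ] _ _ = sum -[1+ 0 ] -[1+ 1 ] refl negative-sign negative-sign
smallInteger (+ suc (suc (suc (suc _)))) (ℤ.+<+ (ℕ.s≤s (ℕ.s≤s (ℕ.s≤s (ℕ.s≤s ()))))) _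
smallInteger -[1+ suc (suc (suc _)) ] _ (ℤ.-<- (ℕ.s≤s (ℕ.s≤s (ℕ.s≤s ()))))

-- From the definitions of `SimplestCubic` to evaluation in the ordered ring, and the elements to
-- discard.

module _ (a : ℤ) (ρ ρ′ ρ″ : ℝ) where
  open Coordinates a
  open ℝ-properties using (pos-trans; +-cong; -‿cong; ι-reflects-<; ι-mono-<)
  open ℝ-properties.Evaluation a
    using (evalAt-rational) renaming (evalAt to evalAtᵣ; IsRoot to IsRootᵣ)

  ⊗≡times : ∀ α β → SimplestCubic._⊗_ a ρ ρ′ ρ″ α β ≡ times α β
  ⊗≡times ⟨ _ , _ , _ ⟩ ⟨ _ , _ , _ ⟩ = refl

  evalAt⇒evalAtᵣ : ∀ x α → SimplestCubic.evalAt a ρ ρ′ ρ″ x α ≃ evalAtᵣ x α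
  evalAt⇒evalAtᵣ x ⟨ p , q , r ⟩ =
    +⇒+ᵣ (fromℤ p + fromℤ q * x) (fromℤ r * x ²)
      (+⇒+ᵣ (fromℤ p) (fromℤ q * x) (fromℤ⇒fromℤᵣ p) (*⇒*ᵣ (fromℤ q) x (fromℤ⇒fromℤᵣ q) ≃-refl))
      (*⇒*ᵣ (fromℤ r) (x ²) (fromℤ⇒fromℤᵣ r) (²⇒*ᵣ x ≃-refl))

  IsRoot⇒IsRootᵣ : ∀ x → IsRoot a x → IsRootᵣ x
  IsRoot⇒IsRootᵣ x root = ≃-trans (≃-sym
    (minus⇒-ᵣ (x ³ - fromℤ a * x ² - fromℤ (a ℤ.+ + 3) * x) (fromℤ (+ 1))
      (minus⇒-ᵣ (x ³ - fromℤ a * x ²) (fromℤ (a ℤ.+ + 3) * x)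
        (minus⇒-ᵣ (x ³) (fromℤ a * x ²)
          (³⇒*ᵣ x ≃-refl) (*⇒*ᵣ (fromℤ a) (x ²) (fromℤ⇒fromℤᵣ a) (²⇒*ᵣ x ≃-refl)))
        (*⇒*ᵣ (fromℤ (a ℤ.+ + 3)) x (fromℤ⇒fromℤᵣ (a ℤ.+ + 3)) ≃-refl))
      (fromℤ⇒fromℤᵣ (+ 1))))
    (≃-trans root (fromℤ⇒fromℤᵣ (+ 0)))

  square-product⇒*ᵣ : ∀ u v w y {y′} → y ≃ y′ →
    v ² * w ² * (- y + u ²) ² ≃
      (v *ᵣ v) *ᵣ (w *ᵣ w) *ᵣ ((-ᵣ y′ +ᵣ u *ᵣ u) *ᵣ (-ᵣ y′ +ᵣ u *ᵣ u))
  square-product⇒*ᵣ u v w y y≃ =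
    *⇒*ᵣ (v ² * w ²) ((- y + u ²) ²)
      (*⇒*ᵣ (v ²) (w ²) (²⇒*ᵣ v ≃-refl) (²⇒*ᵣ w ≃-refl))
      (²⇒*ᵣ (- y + u ²) (+⇒+ᵣ (- y) (u ²) (-⇒-ᵣ y y≃) (²⇒*ᵣ u ≃-refl)))

  real⇒evalAtᵣ : ∀ α → SimplestCubic.real a ρ ρ′ ρ″ α ≃ evalAtᵣ ρ α
  real⇒evalAtᵣ α = evalAt⇒evalAtᵣ ρ α

  conj′⇒evalAtᵣ : ∀ α → SimplestCubic.conj′ a ρ ρ′ ρ″ α ≃ evalAtᵣ ρ′ α
  conj′⇒evalAtᵣ α = evalAt⇒evalAtᵣ ρ′ α

  conj″⇒evalAtᵣ : ∀ α → SimplestCubic.conj″ a ρ ρ′ ρ″ α ≃ evalAtᵣ ρ″ α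
  conj″⇒evalAtᵣ α = evalAt⇒evalAtᵣ ρ″ α

  -- A bound C above δ is passed on to α by transitivity in the strict case and unchanged in the
  -- case of equality.
  ⪰⇒pos : ∀ {δ α δ′ α′} → δ ≡ δ′ → α ≡ α′ → SimplestCubic._⪰_ a ρ ρ′ ρ″ δ α → ∀ {C} →
    (Pos (C +ᵣ -ᵣ evalAtᵣ ρ δ′) → Pos (C +ᵣ -ᵣ evalAtᵣ ρ α′)) ×
    (Pos (C +ᵣ -ᵣ evalAtᵣ ρ′ δ′) → Pos (C +ᵣ -ᵣ evalAtᵣ ρ′ α′)) ×
    (Pos (C +ᵣ -ᵣ evalAtᵣ ρ″ δ′) → Pos (C +ᵣ -ᵣ evalAtᵣ ρ″ α′))
  ⪰⇒pos {δ} {α} refl refl (inj₁ (lt , lt′ , lt″)) =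
      (λ δ<C → pos-trans δ<C
        (pos-resp (+-cong (real⇒evalAtᵣ δ) (-‿cong (real⇒evalAtᵣ α))) (<⇒pos lt)))
    , (λ δ<C → pos-trans δ<C
        (pos-resp (+-cong (conj′⇒evalAtᵣ δ) (-‿cong (conj′⇒evalAtᵣ α))) (<⇒pos lt′)))
    , (λ δ<C → pos-trans δ<C
        (pos-resp (+-cong (conj″⇒evalAtᵣ δ) (-‿cong (conj″⇒evalAtᵣ α))) (<⇒pos lt″)))
  ⪰⇒pos refl refl (inj₂ refl) = (λ p → p) , (λ p → p) , (λ p → p)

  rational-value : ∀ x k → SimplestCubic.evalAt a ρ ρ′ ρ″ x ⟨ k , + 0 , + 0 ⟩ ≃ fromℤᵣ k
  rational-value x k =
    ≃-trans (evalAt⇒evalAtᵣ x ⟨ k , + 0 , + 0 ⟩) (evalAt-rational x k)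

  rational-sign⁻ : ∀ s x k →
    HasSign s (SimplestCubic.evalAt a ρ ρ′ ρ″ x ⟨ k , + 0 , + 0 ⟩) → HasSignℤ s k
  rational-sign⁻ Sign.+ x k 0<k = ι-reflects-<
    (pos-resp (+-cong (rational-value x k) (-‿cong (fromℤ⇒fromℤᵣ (+ 0)))) (<⇒pos 0<k))
  rational-sign⁻ Sign.- x k k<0 = ι-reflects-<
    (pos-resp (+-cong (fromℤ⇒fromℤᵣ (+ 0)) (-‿cong (rational-value x k))) (<⇒pos k<0))

  rational-sign⁺ : ∀ s x k → HasSignℤ s k →
    HasSign s (SimplestCubic.evalAt a ρ ρ′ ρ″ x ⟨ k , + 0 , + 0 ⟩)
  rational-sign⁺ Sign.+ x k 0<k = pos⇒< (pos-resp
    (≃-sym (+-cong (rational-value x k) (-‿cong (fromℤ⇒fromℤᵣ (+ 0))))) (ι-mono-< 0<k))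
  rational-sign⁺ Sign.- x k k<0 = pos⇒< (pos-resp
    (≃-sym (+-cong (fromℤ⇒fromℤᵣ (+ 0)) (-‿cong (rational-value x k)))) (ι-mono-< k<0))

  -- A rational integer has the same value at every root, so its signature reduces to signs of
  -- integers, one component at a time.
  rational-signature : ∀ σ {k l} → (∀ s → HasSignℤ s k → HasSignℤ s l) →
    SimplestCubic.HasSignature a ρ ρ′ ρ″ σ ⟨ k , + 0 , + 0 ⟩ →
    SimplestCubic.HasSignature a ρ ρ′ ρ″ σ ⟨ l , + 0 , + 0 ⟩
  rational-signature (s , s′ , s″) {k} {l} f (h , h′ , h″) =
      rational-sign⁺ s ρ l (f s (rational-sign⁻ s ρ k h))
    , rational-sign⁺ s′ ρ′ l (f s′ (rational-sign⁻ s′ ρ′ k h′))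
    , rational-sign⁺ s″ ρ″ l (f s″ (rational-sign⁻ s″ ρ″ k h″))

  rational-sum-decomposable : ∀ σ {m} k l → m ≡ k ℤ.+ l →
    (∀ s → HasSignℤ s m → HasSignℤ s k) → (∀ s → HasSignℤ s m → HasSignℤ s l) →
    ¬ SimplestCubic.Indecomposable a ρ ρ′ ρ″ σ ⟨ m , + 0 , + 0 ⟩
  rational-sum-decomposable σ k l m≡k+l f g (h , ¬split) =
    ¬split (⟨ k , + 0 , + 0 ⟩ , ⟨ l , + 0 , + 0 ⟩
           , rational-signature σ f h , rational-signature σ g h
           , cong (λ m → ⟨ m , + 0 , + 0 ⟩) m≡k+l)

  small-rational : ∀ σ {k} → SmallInteger k →
    SimplestCubic.Indecomposable a ρ ρ′ ρ″ σ ⟨ k , + 0 , + 0 ⟩ →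
    SimplestCubic.IsUnit a ρ ρ′ ρ″ ⟨ k , + 0 , + 0 ⟩
  small-rational σ {k} (zero k≡0) ((h , _) , _) =
    ⊥-elim (nonzero-sign (proj₁ σ) k (rational-sign⁻ (proj₁ σ) ρ k h) k≡0)
  small-rational σ {k} (unit k²≡1) _ = ⟨ k , + 0 , + 0 ⟩
    , trans (⊗≡times ⟨ k , + 0 , + 0 ⟩ ⟨ k , + 0 , + 0 ⟩)
        (trans (times-rational k k) (cong (λ m → ⟨ m , + 0 , + 0 ⟩) k²≡1))
  small-rational σ (sum l m k≡l+m f g) indec =
    ⊥-elim (rational-sum-decomposable σ l m k≡l+m f g indec)

  ±ρ-unit : ∀ {β} → β ≡ embed (+ 0) (+ 1) (+ 0) ⊎ β ≡ ⊖ embed (+ 0) (+ 1) (+ 0) →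
            SimplestCubic.IsUnit a ρ ρ′ ρ″ β
  ±ρ-unit (inj₁ refl) = ρ⁻¹ , trans (⊗≡times (embed (+ 0) (+ 1) (+ 0)) ρ⁻¹) ρ-inverse
  ±ρ-unit (inj₂ refl) = ⊖ ρ⁻¹
    , trans (⊗≡times (⊖ embed (+ 0) (+ 1) (+ 0)) (⊖ ρ⁻¹))
        (trans (⊖-times (embed (+ 0) (+ 1) (+ 0)) ρ⁻¹) ρ-inverse)

  ±-square : ∀ {α β} → β ≡ α ⊎ β ≡ ⊖ α → SimplestCubic._⊗_ a ρ ρ′ ρ″ β β ≡ times α α
  ±-square {α} (inj₁ refl) = ⊗≡times α α
  ±-square {α} (inj₂ refl) = trans (⊗≡times (⊖ α) (⊖ α)) (⊖-times α α)

  ±-rational : ∀ {β} x → β ≡ embed x (+ 0) (+ 0) ⊎ β ≡ ⊖ embed x (+ 0) (+ 0) →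
               β ≡ ⟨ x , + 0 , + 0 ⟩ ⊎ β ≡ ⟨ ℤ.- x , + 0 , + 0 ⟩
  ±-rational x (inj₁ eq) = inj₁ (trans eq (embed-rational x))
  ±-rational x (inj₂ eq) = inj₂ (trans eq (cong ⊖_ (embed-rational x)))

  rational-unit : ∀ σ {β x} → x ℤ.< + 4 → -[1+ 3 ] ℤ.< x →
    β ≡ ⟨ x , + 0 , + 0 ⟩ ⊎ β ≡ ⟨ ℤ.- x , + 0 , + 0 ⟩ →
    SimplestCubic.Indecomposable a ρ ρ′ ρ″ σ β → SimplestCubic.IsUnit a ρ ρ′ ρ″ β
  rational-unit σ {x = x} x<4 -4<x (inj₁ refl) indec =
    small-rational σ {x} (smallInteger x x<4 -4<x) indec
  rational-unit σ {x = x} x<4 -4<x (inj₂ refl) indec =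
    small-rational σ {ℤ.- x} (smallInteger (ℤ.- x) (ℤₚ.neg-mono-< -4<x) (ℤₚ.neg-mono-< x<4)) indec

-- Discarding units and decomposables, and matching the remaining squares with the list.

lemma3p3 : (a : ℤ) → + 15 ℤ.≤ a →
    (ρ ρ′ ρ″ : ℝ) →
    IsRoot a ρ → IsRoot a ρ′ → IsRoot a ρ″ →
    fromℤ (a ℤ.+ + 1) < ρ →
    fromℤ (ℤ.- (+ 2)) < ρ′ → ρ′ < fromℤ (ℤ.- (+ 1)) →
    fromℤ (ℤ.- (+ 1)) < ρ″ → ρ″ < fromℤ (+ 0) →
    let open SimplestCubic a ρ ρ′ ρ″ in
    (β : ℤ[ρ]) (σ : Signature) →
    Indecomposable σ β → ¬ IsUnit β →
    γ ⪰ (β ⊗ β) →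
    ((β ⊗ β) is ⟨ + 1 , ℤ.- (+ 2) , + 1 ⟩
    equalTo (ρ′ ² * ρ″ ² * (- ρ + ρ ²) ²))
    ⊎ ((β ⊗ β) is ⟨ a ℤ.* a ℤ.+ a ℤ.+ + 1 , a ℤ.* a ℤ.- a ℤ.+ + 1 , ℤ.- (a ℤ.- + 1) ⟩
    equalTo (ρ″ ² * ρ ² * (- ρ′ + ρ′ ²) ²))
    ⊎ ((β ⊗ β) is ⟨ a ℤ.* a ℤ.- a , a ℤ.* a ℤ.- + 3 ℤ.* a ℤ.+ + 1 , ℤ.- (a ℤ.- + 3) ⟩
    equalTo (ρ″ ² * ρ ² * (- (fromℤ (+ 2) * ρ′) + ρ′ ²) ²))
    ⊎ ((β ⊗ β) is ⟨ a ℤ.* a ℤ.+ a ℤ.- + 1 , a ℤ.* a ℤ.- a ℤ.- + 3 , ℤ.- (a ℤ.- + 2) ⟩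
    equalTo (ρ ² * ρ′ ² * (- (fromℤ (a ℤ.- + 1) * ρ″) + ρ″ ²) ²))
lemma3p3 a 15≤a ρ ρ′ ρ″ root root′ root″ ρ>a+1 _ ρ′<-1 ρ″>-1 ρ″<0 β σ indec ¬unit γ⪰β² =
  case candidate of λ where
    (x , _ , _ , rational x<4 -4<x , β≡) → ⊥-elim (¬unit
      (rational-unit a ρ ρ′ ρ″ σ x<4 -4<x (±-rational a ρ ρ′ ρ″ x β≡) indec))
    (_ , _ , _ , [ρ] , β≡) → ⊥-elim (¬unit (±ρ-unit a ρ ρ′ ρ″ β≡))
    (_ , _ , _ , [ρ-1] , β≡) → inj₁
      (listed β≡ [ρ-1]² (square-product⇒*ᵣ a ρ ρ′ ρ″ ρ ρ′ ρ″ ρ ≃-refl) [ρ-1]²-product)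
    (_ , _ , _ , [ρ′-1] , β≡) → inj₂ (inj₁
      (listed β≡ [ρ′-1]² (square-product⇒*ᵣ a ρ ρ′ ρ″ ρ′ ρ″ ρ ρ′ ≃-refl) [ρ′-1]²-product))
    (_ , _ , _ , [ρ′-2] , β≡) → inj₂ (inj₂ (inj₁
      (listed β≡ [ρ′-2]²
        (square-product⇒*ᵣ a ρ ρ′ ρ″ ρ′ ρ″ ρ (fromℤ (+ 2) * ρ′)
          (*⇒*ᵣ (fromℤ (+ 2)) ρ′ (fromℤ⇒fromℤᵣ (+ 2)) ≃-refl))
        [ρ′-2]²-product)))
    (_ , _ , _ , [ρ+ρ′-1] , β≡) → inj₂ (inj₂ (inj₂
      (listed β≡ [ρ+ρ′-1]²
        (square-product⇒*ᵣ a ρ ρ′ ρ″ ρ″ ρ ρ′ (fromℤ (a ℤ.- + 1) * ρ″)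
          (*⇒*ᵣ (fromℤ (a ℤ.- + 1)) ρ″ (fromℤ⇒fromℤᵣ (a ℤ.- + 1)) ≃-refl))
        [ρ+ρ′-1]²-product)))
  where
  open Coordinates a
  open ℝ-properties.Evaluation a using () renaming (evalAt to evalAtᵣ)
  open ℝ-properties.Evaluation.Conjugates a 15≤a
    (IsRoot⇒IsRootᵣ a ρ ρ′ ρ″ ρ root) (IsRoot⇒IsRootᵣ a ρ ρ′ ρ″ ρ′ root′)
    (IsRoot⇒IsRootᵣ a ρ ρ′ ρ″ ρ″ root″)
    (fromℤ<⇒pos ρ>a+1) (<fromℤ⇒pos ρ′<-1) (fromℤ<⇒pos ρ″>-1) (<fromℤ⇒pos ρ″<0)

  -- An η-expansion of γ⪰β², after which the conversion check sees rational terms and no proofs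
  -- that a sequence is Cauchy.
  γ⪰ββ : SimplestCubic._⪰_ a ρ ρ′ ρ″ (SimplestCubic.γ a ρ ρ′ ρ″) (SimplestCubic._⊗_ a ρ ρ′ ρ″ β β)
  γ⪰ββ = case γ⪰β² of λ where
    (inj₁ (mk< g 0<g N below , mk< g′ 0<g′ N′ below′ , mk< g″ 0<g″ N″ below″)) →
      inj₁ (mk< g 0<g N below , mk< g′ 0<g′ N′ below′ , mk< g″ 0<g″ N″ below″)
    (inj₂ γ≡β²) → inj₂ γ≡β²

  below : ∀ {C} →
    (Pos (C +ᵣ -ᵣ evalAtᵣ ρ γ̂) → Pos (C +ᵣ -ᵣ evalAtᵣ ρ (times β β))) ×
    (Pos (C +ᵣ -ᵣ evalAtᵣ ρ′ γ̂) → Pos (C +ᵣ -ᵣ evalAtᵣ ρ′ (times β β))) ×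
    (Pos (C +ᵣ -ᵣ evalAtᵣ ρ″ γ̂) → Pos (C +ᵣ -ᵣ evalAtᵣ ρ″ (times β β)))
  below = ⪰⇒pos a ρ ρ′ ρ″ {SimplestCubic.γ a ρ ρ′ ρ″} {SimplestCubic._⊗_ a ρ ρ′ ρ″ β β}
    {γ̂} {times β β} refl (⊗≡times a ρ ρ′ ρ″ β β) γ⪰ββ

  candidate : ∃[ x ] ∃[ y ] ∃[ z ] Candidate x y z × (β ≡ embed x y z ⊎ β ≡ ⊖ embed x y z)
  candidate =
    let x , y , z , β≡xyz = embed-surjective β
    in [ (λ c → x , y , z , c , inj₁ β≡xyz)
       , (λ c → ℤ.- x , ℤ.- y , ℤ.- z , c , inj₂ (trans β≡xyz (⊖-embed x y z))) ]′
       (candidates x y z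
         (subst (SquareBelowγ ρ) β≡xyz λ {C} → proj₁ (below {C}))
         (subst (SquareBelowγ ρ′) β≡xyz λ {C} → proj₁ (proj₂ (below {C})))
         (subst (SquareBelowγ ρ″) β≡xyz λ {C} → proj₂ (proj₂ (below {C}))))

  -- β and -β have the same square, so knowing β up to sign is enough.
  listed : ∀ {α δ v v′} → β ≡ α ⊎ β ≡ ⊖ α → times α α ≡ δ → v ≃ v′ → v′ ≃ evalAtᵣ ρ (times α α) →
           SimplestCubic._⊗_ a ρ ρ′ ρ″ β β ≡ δ × v ≃ SimplestCubic.real a ρ ρ′ ρ″ δ
  listed {δ = δ} β≡±α α²≡δ v≃v′ v′≃α² = trans (±-square a ρ ρ′ ρ″ β≡±α) α²≡δ
    , ≃-trans v≃v′ (≃-trans (subst (λ δ → _ ≃ evalAtᵣ ρ δ) α²≡δ v′≃α²)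
        (≃-sym (real⇒evalAtᵣ a ρ ρ′ ρ″ δ)))
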